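{- Let $\mathbb C$ be a (strict) Cartesian differential category with differential operator $D$. Then the operation $\mathcal D^*:\mathrm{St}(\mathbb C)(\mathbf X,\mathbf Y)\to\mathrm{St}(\mathbb C)(\mathbf X\times\mathbf X,\mathbf Y)$, $\mathcal D^*(i,\mathbf s)=(U\mathcal D(i^v),[\mathcal D\mathbf s_k]_k)$, is a Cartesian differential operator on $\mathrm{St}(\mathbb C)$ (with its componentwise left additive structure); that is, it satisfies axioms CD1–CD7, so $\mathrm{St}(\mathbb C)$ is a Cartesian differential category.
   Context: Categories are Cartesian with strictly associative and unital chosen products $\times$, terminal object $1$, $!_X:X\to1$, diagonal $\Delta_X=\langle \mathrm{id}_X,\mathrm{id}_X\rangle$, symmetry $\sigma_{X,Y}:X\times Y\to Y\times X$. An object's name also denotes its identity morphism. Equations may be written with generalized elements. $[e_k]_k$ denotes the $\mathbb N$-indexed sequence with entries $e_k$. Left additive category: a Cartesian category in which every object $X$ carries a designated commutative monoid structure $+_X:X\times X\to X$, $0_X:1\to X$ such that $0_{X\times Y}=0_X\times0_Y$ and $+_{X\times Y}=(+_X\times+_Y)\circ(X\times\sigma_{Y,X}\times Y)$. Notation: $\delta_{X,Y}=X\times\sigma_{Y,X}\times Y$; $\alpha_X=\delta_{X,X}\circ(X\times X\times\Delta_X)$; $\zeta_X=X\times0_{X\times X}\times X:X\times X\to X^4$. Cartesian differential category: a left additive category with a Cartesian differential operator, i.e. functions $D:\mathbb C(X,Y)\to\mathbb C(X\times X,Y)$ such that for all $f:X\to Y$, $g:Y\to Z$, $h:V\to W$: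 CD1. $Ds=s\times{!_{\mathrm{dom}(s)}}$ for $s\in\{\mathrm{id}_X,\sigma_{X,Y},!_X,\Delta_X,+_X,0_X\}$; CD2. $Df\circ(0_X\times X)=0_Y\circ{!_X}$; CD3. $Df\circ(+_X\times X)=+_Y\circ(Df\times Df)\circ\alpha_X$; CD4. $D(g\circ f)=Dg\circ(Df\times f)\circ(X\times\Delta_X)$; CD5. $D(f\times h)=(Df\times Dh)\circ\delta_{X,V}$; CD6. $DDf\circ\zeta_X=Df$; CD7. $DDf\circ\delta_{X,X}=DDf$. 2-cells: a 2-cell $f$ consists of objects $S=\mathrm{prv}\,f$, $X=\mathrm{dom}\,f$, $S'=\mathrm{nxt}\,f$, $Y=\mathrm{cod}\,f$ together with an underlying morphism $Uf:S\times X\to S'\times Y$ in $\mathbb C$. Horizontal composition: if also $g$ has $Ug:T\times Y\to T'\times Z$, then $g*f$ has $\mathrm{prv}=S\times T$, $\mathrm{dom}=X$, $\mathrm{nxt}=S'\times T'$, $\mathrm{cod}=Z$ and $U(g*f)(s,t,x)=(s',t',z)$ where $(s',y)=Uf(s,x)$, $(t',z)=Ug(t,y)$. Vertical composition: if $h$ has $Uh:S'\times V\to S''\times W$, then $f;h$ has $\mathrm{prv}=S$, $\mathrm{dom}=X\times V$, $\mathrm{nxt}=S''$, $\mathrm{cod}=Y\times W$ and $U(f;h)(s,x,v)=(s'',y,w)$ where $(s',y)=Uf(s,x)$, $(s'',w)=Uh(s',v)$. For $\phi:X\to Y$ in $\mathbb C$, $\phi^h$ is the 2-cell with underlying morphism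 $\phi$, $\mathrm{prv}=\mathrm{nxt}=1$, $\mathrm{dom}=X$, $\mathrm{cod}=Y$; $\phi^v$ is the 2-cell with underlying morphism $\phi$, $\mathrm{prv}=X$, $\mathrm{nxt}=Y$, $\mathrm{dom}=\mathrm{cod}=1$. Stateful morphism sequences: for $\mathbf X,\mathbf Y\in|\mathbb C|^{\mathbb N}$, a stateful morphism sequence $(i,\mathbf s):\mathbf X\to\mathbf Y$ is a sequence $\mathbf s$ of 2-cells with $\mathrm{dom}\,\mathbf s_k=\mathbf X_k$, $\mathrm{cod}\,\mathbf s_k=\mathbf Y_k$, $\mathrm{nxt}\,\mathbf s_k=\mathrm{prv}\,\mathbf s_{k+1}$ for all $k$, and a morphism $i:1\to\mathrm{prv}\,\mathbf s_0$. Its $n$th truncation is $\mathrm{Tc}_n(i,\mathbf s)=U(i^v;\mathbf s_0;\cdots;\mathbf s_n;(!_{\mathrm{nxt}\,\mathbf s_n})^v):\prod_{k=0}^n\mathbf X_k\to\prod_{k=0}^n\mathbf Y_k$. Two stateful morphism sequences $\mathbf X\to\mathbf Y$ are extensionally equal if all their truncations agree. $\mathrm{St}(\mathbb C)$ has objects $|\mathbb C|^{\mathbb N}$ and morphisms the extensional equivalence classes of stateful morphism sequences. Identity on $\mathbf X$: $(\mathrm{id}_1,[(\mathrm{id}_{\mathbf X_k})^h]_k)$. Composition of $(j,\mathbf t):\mathbf X\to\mathbf Y$ and $(i,\mathbf s):\mathbf Y\to\mathbf Z$: $(\langle j,i\rangle,[\mathbf s_k*\mathbf t_k]_k)$ (well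 defined on classes). $\mathrm{St}(\mathbb C)$ is Cartesian with terminal object $[1]$, $\mathbf X\times\mathbf Y=[\mathbf X_k\times\mathbf Y_k]_k$ and projections $(\mathrm{id}_1,[\pi_n^h]_k)$. It is left additive with $+_{\mathbf X}=(\mathrm{id}_1,[(+_{\mathbf X_k})^h]_k)$ and $0_{\mathbf X}=(\mathrm{id}_1,[(0_{\mathbf X_k})^h]_k)$. The operation $\mathcal D$ on 2-cells: for $f$ with $Uf:S\times X\to S'\times Y$, $\mathcal Df$ is the 2-cell with $\mathrm{prv}=S\times S$, $\mathrm{dom}=X\times X$, $\mathrm{nxt}=S'\times S'$, $\mathrm{cod}=Y$ and $U(\mathcal Df)(\dot s,s,\dot x,x)=(\dot s',s',\dot y)$, where $(\dot s',\dot y)=D(Uf)(\dot s,\dot x,s,x)$ and $s'$ is the $S'$-component of $Uf(s,x)$. The operation $\mathcal D^*$ is well defined on extensional equivalence classes. -}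

module Defs where

open import Level using (Level; _⊔_) renaming (suc to lsuc)
open import Data.Nat using (ℕ; zero; suc)
open import Relation.Binary using (Rel; IsEquivalence)

-- Strictness of products is an equation between objects, so categories
-- carry an equality _≐_ of objects along with the equality _≈_ of parallel
-- morphisms.  Where an equation between objects p : X ≐ Y is used to
-- identify hom-sets, ↑ p : X ⇒ Y is the identity of X seen as a morphism to
-- Y.  A category with a set of objects is the case where _≐_ is _≡_ and
-- ↑ refl is the identity; having _≐_ abstract lets sequences of objects be
-- compared entrywise without function extensionality.

record RawLeftAdditiveCategory (o p ℓ e : Level) : Set (lsuc (o ⊔ p ⊔ ℓ ⊔ e)) where
  infix  4 _≐_ _⇒_ _≈_
  infixr 9 _∘_
  infixr 7 _×_ _⊗_
  field
    Obj  : Set o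
    _≐_  : Rel Obj p
    _⇒_  : Obj → Obj → Set ℓ
    _≈_  : ∀ {X Y} → Rel (X ⇒ Y) e
    id   : ∀ {X} → X ⇒ X
    _∘_  : ∀ {X Y Z} → Y ⇒ Z → X ⇒ Y → X ⇒ Z

    ≐-isEquivalence : IsEquivalence _≐_
    ↑               : ∀ {X Y} → X ≐ Y → X ⇒ Y

    𝟙     : Obj
    _×_   : Obj → Obj → Obj
    !     : ∀ {X} → X ⇒ 𝟙
    π₁    : ∀ {X Y} → X × Y ⇒ X
    π₂    : ∀ {X Y} → X × Y ⇒ Y
    ⟨_,_⟩ : ∀ {X Y Z} → X ⇒ Y → X ⇒ Z → X ⇒ Y × Z

    ×-cong      : ∀ {X X′ Y Y′} → X ≐ X′ → Y ≐ Y′ → X × Y ≐ X′ × Y′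
    ×-assoc     : ∀ X Y Z → (X × Y) × Z ≐ X × (Y × Z)
    ×-identityˡ : ∀ X → 𝟙 × X ≐ X
    ×-identityʳ : ∀ X → X × 𝟙 ≐ X

    +[_] : ∀ X → X × X ⇒ X
    0[_] : ∀ X → 𝟙 ⇒ X

  module ≐ = IsEquivalence ≐-isEquivalence

  _⊗_ : ∀ {X X′ Y Y′} → X ⇒ X′ → Y ⇒ Y′ → X × Y ⇒ X′ × Y′
  f ⊗ g = ⟨ f ∘ π₁ , g ∘ π₂ ⟩

  Δ : ∀ X → X ⇒ X × X
  Δ X = ⟨ id , id ⟩

  σ : ∀ X Y → X × Y ⇒ Y × X
  σ X Y = ⟨ π₂ , π₁ ⟩

  cast : ∀ {X X′ Y Y′} → X ≐ X′ → Y ≐ Y′ → X ⇒ Y → X′ ⇒ Y′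
  cast p q f = ↑ q ∘ f ∘ ↑ (≐.sym p)

  rebracket : ∀ V X Y Z → (V × X) × (Y × Z) ≐ V × ((X × Y) × Z)
  rebracket V X Y Z = ≐.trans (×-assoc V X (Y × Z)) (×-cong ≐.refl (≐.sym (×-assoc X Y Z)))

  δ : ∀ X Y → (X × Y) × (X × Y) ⇒ (X × X) × (Y × Y)
  δ X Y = ↑ (≐.sym (rebracket X X Y Y)) ∘ (id ⊗ (σ Y X ⊗ id)) ∘ ↑ (rebracket X Y X Y)

  α : ∀ X → (X × X) × X ⇒ (X × X) × (X × X)
  α X = δ X X ∘ (id ⊗ Δ X)

  ζ : ∀ X → X × X ⇒ (X × X) × (X × X)
  ζ X = ↑ (≐.sym (rebracket X X X X)) ∘ (id ⊗ (0[ X × X ] ⊗ id)) ∘ ↑ (×-cong ≐.refl (≐.sym (×-identityˡ X)))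

module _ {o p ℓ e : Level} (C : RawLeftAdditiveCategory o p ℓ e) where
  open RawLeftAdditiveCategory C

  -- The laws of ↑ also make ↑ p independent of the proof p.
  record IsCategory : Set (o ⊔ p ⊔ ℓ ⊔ e) where
    field
      ≈-isEquivalence : ∀ {X Y} → IsEquivalence (_≈_ {X} {Y})
      ∘-cong    : ∀ {X Y Z} {g g′ : Y ⇒ Z} {f f′ : X ⇒ Y} → g ≈ g′ → f ≈ f′ → g ∘ f ≈ g′ ∘ f′
      assoc     : ∀ {W X Y Z} (h : Y ⇒ Z) (g : X ⇒ Y) (f : W ⇒ X) → (h ∘ g) ∘ f ≈ h ∘ (g ∘ f)
      identityˡ : ∀ {X Y} (f : X ⇒ Y) → id ∘ f ≈ f
      identityʳ : ∀ {X Y} (f : X ⇒ Y) → f ∘ id ≈ f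
      ↑-id      : ∀ {X} (q : X ≐ X) → ↑ q ≈ id
      ↑-trans   : ∀ {X Y Z} (q : X ≐ Y) (r : Y ≐ Z) → ↑ (≐.trans q r) ≈ ↑ r ∘ ↑ q

  -- Products are strict: the canonical associator and unitors are identities.
  record IsStrictCartesian : Set (o ⊔ p ⊔ ℓ ⊔ e) where
    field
      isCategory  : IsCategory
      !-unique    : ∀ {X} (f : X ⇒ 𝟙) → ! ≈ f
      project₁    : ∀ {X Y Z} (f : X ⇒ Y) (g : X ⇒ Z) → π₁ ∘ ⟨ f , g ⟩ ≈ f
      project₂    : ∀ {X Y Z} (f : X ⇒ Y) (g : X ⇒ Z) → π₂ ∘ ⟨ f , g ⟩ ≈ g
      ⟨⟩-unique   : ∀ {X Y Z} {f : X ⇒ Y} {g : X ⇒ Z} {h : X ⇒ Y × Z} →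
                    π₁ ∘ h ≈ f → π₂ ∘ h ≈ g → ⟨ f , g ⟩ ≈ h
      ↑-×         : ∀ {X X′ Y Y′} (q : X ≐ X′) (r : Y ≐ Y′) → ↑ (×-cong q r) ≈ ↑ q ⊗ ↑ r
      ↑-assoc     : ∀ X Y Z → ↑ (×-assoc X Y Z) ≈ ⟨ π₁ ∘ π₁ , ⟨ π₂ ∘ π₁ , π₂ ⟩ ⟩
      ↑-identityˡ : ∀ X → ↑ (×-identityˡ X) ≈ π₂
      ↑-identityʳ : ∀ X → ↑ (×-identityʳ X) ≈ π₁
    open IsCategory isCategory public

  record IsLeftAdditiveCategory : Set (o ⊔ p ⊔ ℓ ⊔ e) where
    field
      isStrictCartesian : IsStrictCartesian
      +-≐         : ∀ {X Y} (q : X ≐ Y) → cast (×-cong q q) q +[ X ] ≈ +[ Y ]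
      0-≐         : ∀ {X Y} (q : X ≐ Y) → cast ≐.refl q 0[ X ] ≈ 0[ Y ]
      +-assoc     : ∀ X → +[ X ] ∘ (+[ X ] ⊗ id) ≈ +[ X ] ∘ (id ⊗ +[ X ]) ∘ ↑ (×-assoc X X X)
      +-comm      : ∀ X → +[ X ] ∘ σ X X ≈ +[ X ]
      +-identityˡ : ∀ X → +[ X ] ∘ (0[ X ] ⊗ id) ≈ ↑ (×-identityˡ X)
      +-identityʳ : ∀ X → +[ X ] ∘ (id ⊗ 0[ X ]) ≈ ↑ (×-identityʳ X)
      0-×         : ∀ X Y → 0[ X × Y ] ≈ (0[ X ] ⊗ 0[ Y ]) ∘ ↑ (≐.sym (×-identityˡ 𝟙))
      +-×         : ∀ X Y → +[ X × Y ] ≈ (+[ X ] ⊗ +[ Y ]) ∘ δ X Y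
    open IsStrictCartesian isStrictCartesian public

  record IsCartesianDifferentialOperator (D : ∀ {X Y} → X ⇒ Y → X × X ⇒ Y) : Set (o ⊔ p ⊔ ℓ ⊔ e) where
    Linear : ∀ {X Y} → X ⇒ Y → Set e
    Linear {X} {Y} s = D s ≈ ↑ (×-identityʳ Y) ∘ (s ⊗ ! {X})
    field
      -- D is a function on morphisms: it respects both equalities.
      D-cong : ∀ {X Y} {f g : X ⇒ Y} → f ≈ g → D f ≈ D g
      D-≐    : ∀ {X X′ Y Y′} (q : X ≐ X′) (r : Y ≐ Y′) (f : X ⇒ Y) →
               D (cast q r f) ≈ cast (×-cong q q) r (D f)

      CD1-id : ∀ X → Linear (id {X})
      CD1-σ  : ∀ X Y → Linear (σ X Y)
      CD1-!  : ∀ X → Linear (! {X})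
      CD1-Δ  : ∀ X → Linear (Δ X)
      CD1-+  : ∀ X → Linear +[ X ]
      CD1-0  : ∀ X → Linear 0[ X ]
      CD2    : ∀ {X Y} (f : X ⇒ Y) → D f ∘ (0[ X ] ⊗ id) ≈ 0[ Y ] ∘ !
      CD3    : ∀ {X Y} (f : X ⇒ Y) → D f ∘ (+[ X ] ⊗ id) ≈ +[ Y ] ∘ (D f ⊗ D f) ∘ α X
      CD4    : ∀ {X Y Z} (f : X ⇒ Y) (g : Y ⇒ Z) →
               D (g ∘ f) ≈ D g ∘ (D f ⊗ f) ∘ ↑ (≐.sym (×-assoc X X X)) ∘ (id ⊗ Δ X)
      CD5    : ∀ {X Y V W} (f : X ⇒ Y) (h : V ⇒ W) → D (f ⊗ h) ≈ (D f ⊗ D h) ∘ δ X V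
      CD6    : ∀ {X Y} (f : X ⇒ Y) → D (D f) ∘ ζ X ≈ D f
      CD7    : ∀ {X Y} (f : X ⇒ Y) → D (D f) ∘ δ X X ≈ D (D f)

  record IsCartesianDifferentialCategory (D : ∀ {X Y} → X ⇒ Y → X × X ⇒ Y) : Set (o ⊔ p ⊔ ℓ ⊔ e) where
    field
      isLeftAdditiveCategory          : IsLeftAdditiveCategory
      isCartesianDifferentialOperator : IsCartesianDifferentialOperator D
    open IsLeftAdditiveCategory isLeftAdditiveCategory public
    open IsCartesianDifferentialOperator isCartesianDifferentialOperator public

record CartesianDifferentialCategory (o p ℓ e : Level) : Set (lsuc (o ⊔ p ⊔ ℓ ⊔ e)) where
  field
    rawLeftAdditiveCategory : RawLeftAdditiveCategory o p ℓ e
  open RawLeftAdditiveCategory rawLeftAdditiveCategory public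
  field
    D : ∀ {X Y} → X ⇒ Y → X × X ⇒ Y
    isCartesianDifferentialCategory : IsCartesianDifferentialCategory rawLeftAdditiveCategory D
  open IsCartesianDifferentialCategory isCartesianDifferentialCategory public

module Stateful {o p ℓ e : Level} (C : RawLeftAdditiveCategory o p ℓ e) where
  open RawLeftAdditiveCategory C

  record TwoCell (prv dom nxt cod : Obj) : Set ℓ where
    constructor cell
    field
      U : prv × dom ⇒ nxt × cod
  open TwoCell public

  infixr 7 _✶_
  infixl 6 _⨾_

  _✶_ : ∀ {S S′ T T′ X Y Z} → TwoCell T Y T′ Z → TwoCell S X S′ Y → TwoCell (S × T) X (S′ × T′) Z
  U (_✶_ {S} {S′} {T} {T′} {X} {Y} {Z} g f) = ⟨ ⟨ π₁ ∘ s′y , π₁ ∘ t′z ⟩ , π₂ ∘ t′z ⟩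
    where
    s′y : (S × T) × X ⇒ S′ × Y
    s′y = U f ∘ ⟨ π₁ ∘ π₁ , π₂ ⟩
    t′z : (S × T) × X ⇒ T′ × Z
    t′z = U g ∘ ⟨ π₂ ∘ π₁ , π₂ ∘ s′y ⟩

  _⨾_ : ∀ {S S′ S″ X Y V W} → TwoCell S X S′ Y → TwoCell S′ V S″ W → TwoCell S (X × V) S″ (Y × W)
  U (_⨾_ {S} {S′} {S″} {X} {Y} {V} {W} f h) = ⟨ π₁ ∘ s″w , ⟨ π₂ ∘ s′y , π₂ ∘ s″w ⟩ ⟩
    where
    s′y : S × (X × V) ⇒ S′ × Y
    s′y = U f ∘ ⟨ π₁ , π₁ ∘ π₂ ⟩
    s″w : S × (X × V) ⇒ S″ × W
    s″w = U h ∘ ⟨ π₁ ∘ s′y , π₂ ∘ π₂ ⟩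

  _ʰ : ∀ {X Y} → X ⇒ Y → TwoCell 𝟙 X 𝟙 Y
  U (_ʰ {X} {Y} φ) = cast (≐.sym (×-identityˡ X)) (≐.sym (×-identityˡ Y)) φ

  _ᵛ : ∀ {X Y} → X ⇒ Y → TwoCell X 𝟙 Y 𝟙
  U (_ᵛ {X} {Y} φ) = cast (≐.sym (×-identityʳ X)) (≐.sym (×-identityʳ Y)) φ

  -- The condition nxt sₖ = prv sₖ₊₁ is built into the indexing by state.
  record StatefulSequence (X Y : ℕ → Obj) : Set (o ⊔ ℓ) where
    constructor stateful
    field
      {state} : ℕ → Obj
      init    : 𝟙 ⇒ state 0
      cells   : ∀ k → TwoCell (state k) (X k) (state (suc k)) (Y k)
  open StatefulSequence public

  -- X₀ × ⋯ × Xₙ₋₁, so that truncation n runs over ∏ (suc n).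
  ∏ : ℕ → (ℕ → Obj) → Obj
  ∏ zero    X = 𝟙
  ∏ (suc n) X = ∏ n X × X n

  -- run f n is iᵛ ⨾ s₀ ⨾ ⋯ ⨾ sₙ₋₁.
  run : ∀ {X Y} (f : StatefulSequence X Y) n → TwoCell 𝟙 (∏ n X) (state f n) (∏ n Y)
  run f zero    = init f ᵛ
  run f (suc n) = run f n ⨾ cells f n

  unpad : ∀ X → 𝟙 × (X × 𝟙) ≐ X
  unpad X = ≐.trans (×-identityˡ (X × 𝟙)) (×-identityʳ X)

  Tc : ∀ {X Y} n → StatefulSequence X Y → ∏ (suc n) X ⇒ ∏ (suc n) Y
  Tc {X} {Y} n f = cast (unpad (∏ (suc n) X)) (unpad (∏ (suc n) Y)) (U (run f (suc n) ⨾ (! ᵛ)))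

  infix 4 _≋_
  record _≋_ {X Y : ℕ → Obj} (f g : StatefulSequence X Y) : Set e where
    constructor extensionally
    field
      truncations : ∀ n → Tc n f ≈ Tc n g
  open _≋_ public

  stateless : ∀ {X Y : ℕ → Obj} → (∀ k → X k ⇒ Y k) → StatefulSequence X Y
  stateless φ = stateful {state = λ _ → 𝟙} id (λ k → φ k ʰ)

  compose : ∀ {X Y Z} → StatefulSequence Y Z → StatefulSequence X Y → StatefulSequence X Z
  compose (stateful i s) (stateful j t) = stateful ⟨ j , i ⟩ (λ k → s k ✶ t k)

  pair : ∀ {X Y Z : ℕ → Obj} → StatefulSequence X Y → StatefulSequence X Z →
         StatefulSequence X (λ k → Y k × Z k)
  pair {X} {Y} {Z} (stateful {S} i s) (stateful {T} j t) = stateful ⟨ i , j ⟩ step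
    where
    step : ∀ k → TwoCell (S k × T k) (X k) (S (suc k) × T (suc k)) (Y k × Z k)
    U (step k) = ⟨ ⟨ π₁ ∘ s′y , π₁ ∘ t′z ⟩ , ⟨ π₂ ∘ s′y , π₂ ∘ t′z ⟩ ⟩
      where
      s′y : (S k × T k) × X k ⇒ S (suc k) × Y k
      s′y = U (s k) ∘ ⟨ π₁ ∘ π₁ , π₂ ⟩
      t′z : (S k × T k) × X k ⇒ T (suc k) × Z k
      t′z = U (t k) ∘ ⟨ π₂ ∘ π₁ , π₂ ⟩

  -- A morphism of St(C) is an extensional equivalence class of stateful
  -- sequences, that is, a sequence taken up to _≋_.
  St : RawLeftAdditiveCategory o p (o ⊔ ℓ) e
  St = record
    { Obj             = ℕ → Obj
    ; _≐_             = λ X Y → ∀ k → X k ≐ Y k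
    ; _⇒_             = StatefulSequence
    ; _≈_             = _≋_
    ; id              = stateless (λ k → id)
    ; _∘_             = compose
    ; ≐-isEquivalence = record
      { refl  = λ k → ≐.refl
      ; sym   = λ q k → ≐.sym (q k)
      ; trans = λ q r k → ≐.trans (q k) (r k)
      }
    ; ↑               = λ q → stateless (λ k → ↑ (q k))
    ; 𝟙               = λ k → 𝟙
    ; _×_             = λ X Y k → X k × Y k
    ; !               = stateless (λ k → !)
    ; π₁              = stateless (λ k → π₁)
    ; π₂              = stateless (λ k → π₂)
    ; ⟨_,_⟩           = pair
    ; ×-cong          = λ q r k → ×-cong (q k) (r k)
    ; ×-assoc         = λ X Y Z k → ×-assoc (X k) (Y k) (Z k)
    ; ×-identityˡ     = λ X k → ×-identityˡ (X k)
    ; ×-identityʳ     = λ X k → ×-identityʳ (X k)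
    ; +[_]            = λ X → stateless (λ k → +[ X k ])
    ; 0[_]            = λ X → stateless (λ k → 0[ X k ])
    }

  module Derivative (D : ∀ {X Y} → X ⇒ Y → X × X ⇒ Y) where

    𝒟 : ∀ {S X S′ Y} → TwoCell S X S′ Y → TwoCell (S × S) (X × X) (S′ × S′) Y
    U (𝒟 {S} {X} {S′} {Y} f) = ⟨ ⟨ π₁ ∘ ṡ′ẏ , s′ ⟩ , π₂ ∘ ṡ′ẏ ⟩
      where
      ṡ′ẏ : (S × S) × (X × X) ⇒ S′ × Y
      ṡ′ẏ = D (U f) ∘ ⟨ ⟨ π₁ ∘ π₁ , π₁ ∘ π₂ ⟩ , ⟨ π₂ ∘ π₁ , π₂ ∘ π₂ ⟩ ⟩
      s′ : (S × S) × (X × X) ⇒ S′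
      s′ = π₁ ∘ U f ∘ ⟨ π₂ ∘ π₁ , π₂ ∘ π₂ ⟩

    𝟙⁴≐𝟙 : (𝟙 × 𝟙) × (𝟙 × 𝟙) ≐ 𝟙
    𝟙⁴≐𝟙 = ≐.trans (×-cong (×-identityˡ 𝟙) (×-identityˡ 𝟙)) (×-identityˡ 𝟙)

    𝒟⋆ : ∀ {X Y : ℕ → Obj} → StatefulSequence X Y → StatefulSequence (λ k → X k × X k) Y
    𝒟⋆ (stateful {S} i s) = stateful
      (cast 𝟙⁴≐𝟙 (×-identityʳ (S 0 × S 0)) (U (𝒟 (i ᵛ))))
      (λ k → 𝒟 (s k))

{-# OPTIONS --safe #-}
module Submission where

-- The truncations of a stateful sequence are a jointly faithful family of
-- functors St(C) → C.  They do not preserve the chosen products, since a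
-- truncation of X × Y interleaves the factors, but they do preserve them up
-- to the isomorphism that unzips ∏ (Xₖ × Yₖ) to ∏ Xₖ × ∏ Yₖ.  That isomorphism
-- is linear, and up to it the truncation of 𝒟⋆ f is D of the truncation of f:
-- this is the chain rule, applied along the run of f.  So every axiom for 𝒟⋆
-- reflects from the same axiom for D at generalized elements of a truncation.

open import Level using (_⊔_)
open import Data.Nat using (ℕ; zero; suc)
open import Relation.Binary using (IsEquivalence; Setoid)
import Relation.Binary.Reasoning.Setoid as SetoidReasoning
open import Defs

-- An axiom cannot be checked cell by cell, because its two sides may have different state spaces.
-- In CD4, `𝒟⋆ (compose g f)` holds two copies of the state of `f`, while the other side holds
-- three: two in `𝒟⋆ f` and one in the `f` beside it. Only the truncations can agree. But
-- truncations forget the state, on which later outputs depend, so an induction on truncations alone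
-- does not close. It is carried by `stateAt`, the state as a function of the inputs consumed so
-- far. The state of `𝒟⋆ f` is then, after unzipping the inputs, the derivative of this function
-- paired with its value at the base inputs, which is why `𝒟` keeps both `ṡ` and `s`. Linearity of
-- the unzipping needs linear projections, and compatibility with `_≐_` needs linear `↑`. CD1 lists
-- neither; both come from strictness and from `D` respecting equality of objects.

-- Strict Cartesian categories: computing at generalized elements.

module CartesianProperties {o p ℓ e} {C : RawLeftAdditiveCategory o p ℓ e} (C-isStrictCartesian : IsStrictCartesian C) where
  open RawLeftAdditiveCategory C
  open IsStrictCartesian C-isStrictCartesian

  hom-setoid : Obj → Obj → Setoid ℓ e
  hom-setoid X Y = record { isEquivalence = ≈-isEquivalence {X} {Y} }

  module _ {X Y : Obj} where
    open IsEquivalence (≈-isEquivalence {X} {Y}) public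
      using () renaming (refl to ≈-refl; sym to ≈-sym; trans to ≈-trans)

  module HomReasoning {X Y : Obj} where
    open SetoidReasoning (hom-setoid X Y) public
  open HomReasoning

  ∘-congˡ : ∀ {X Y Z} {g : Y ⇒ Z} {f f′ : X ⇒ Y} → f ≈ f′ → g ∘ f ≈ g ∘ f′
  ∘-congˡ = ∘-cong ≈-refl

  ∘-congʳ : ∀ {X Y Z} {g g′ : Y ⇒ Z} {f : X ⇒ Y} → g ≈ g′ → g ∘ f ≈ g′ ∘ f
  ∘-congʳ q = ∘-cong q ≈-refl

  ⟨⟩-cong : ∀ {X Y Z} {f f′ : X ⇒ Y} {g g′ : X ⇒ Z} → f ≈ f′ → g ≈ g′ → ⟨ f , g ⟩ ≈ ⟨ f′ , g′ ⟩
  ⟨⟩-cong q r = ⟨⟩-unique (≈-trans (project₁ _ _) (≈-sym q)) (≈-trans (project₂ _ _) (≈-sym r))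

  ⟨⟩-∘ : ∀ {W X Y Z} (f : X ⇒ Y) (g : X ⇒ Z) (h : W ⇒ X) → ⟨ f , g ⟩ ∘ h ≈ ⟨ f ∘ h , g ∘ h ⟩
  ⟨⟩-∘ f g h = ≈-sym (⟨⟩-unique
    (≈-trans (≈-sym (assoc _ _ _)) (∘-congʳ (project₁ _ _)))
    (≈-trans (≈-sym (assoc _ _ _)) (∘-congʳ (project₂ _ _))))

  ⟨⟩-η : ∀ {X Y Z} (h : X ⇒ Y × Z) → ⟨ π₁ ∘ h , π₂ ∘ h ⟩ ≈ h
  ⟨⟩-η h = ⟨⟩-unique ≈-refl ≈-refl

  π-jointlyMonic : ∀ {X Y Z} {f g : X ⇒ Y × Z} → π₁ ∘ f ≈ π₁ ∘ g → π₂ ∘ f ≈ π₂ ∘ g → f ≈ g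
  π-jointlyMonic q r = ≈-trans (≈-sym (⟨⟩-η _)) (⟨⟩-unique (≈-sym q) (≈-sym r))

  ⊗-cong : ∀ {X X′ Y Y′} {f f′ : X ⇒ X′} {g g′ : Y ⇒ Y′} → f ≈ f′ → g ≈ g′ → f ⊗ g ≈ f′ ⊗ g′
  ⊗-cong q r = ⟨⟩-cong (∘-congʳ q) (∘-congʳ r)

  !-unique₂ : ∀ {X} {f g : X ⇒ 𝟙} → f ≈ g
  !-unique₂ = ≈-trans (≈-sym (!-unique _)) (!-unique _)

  -- A lemma named …-at computes the value of a morphism at a generalized
  -- element x : Γ ⇒ X.

  ∘-at : ∀ {Γ X Y Z} {g : Y ⇒ Z} {f : X ⇒ Y} {x : Γ ⇒ X} {y z} → f ∘ x ≈ y → g ∘ y ≈ z → (g ∘ f) ∘ x ≈ z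
  ∘-at q r = ≈-trans (assoc _ _ _) (≈-trans (∘-congˡ q) r)

  ⟨⟩-at : ∀ {Γ X Y Z} {f : X ⇒ Y} {g : X ⇒ Z} {x : Γ ⇒ X} {y z} → f ∘ x ≈ y → g ∘ x ≈ z → ⟨ f , g ⟩ ∘ x ≈ ⟨ y , z ⟩
  ⟨⟩-at q r = ≈-trans (⟨⟩-∘ _ _ _) (⟨⟩-cong q r)

  π₁-at : ∀ {Γ X Y} {x : Γ ⇒ X} {y : Γ ⇒ Y} → π₁ ∘ ⟨ x , y ⟩ ≈ x
  π₁-at = project₁ _ _

  π₂-at : ∀ {Γ X Y} {x : Γ ⇒ X} {y : Γ ⇒ Y} → π₂ ∘ ⟨ x , y ⟩ ≈ y
  π₂-at = project₂ _ _

  id-at : ∀ {Γ X} {x : Γ ⇒ X} → id ∘ x ≈ x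
  id-at = identityˡ _

  ⊗-at : ∀ {Γ X X′ Y Y′} {f : X ⇒ X′} {g : Y ⇒ Y′} {x : Γ ⇒ X} {y : Γ ⇒ Y} {x′ y′} →
         f ∘ x ≈ x′ → g ∘ y ≈ y′ → (f ⊗ g) ∘ ⟨ x , y ⟩ ≈ ⟨ x′ , y′ ⟩
  ⊗-at q r = ⟨⟩-at (∘-at π₁-at q) (∘-at π₂-at r)

  -- At `suc n` an entrywise map `∏-map` is a `⊗`. Extracting one factor of an equation under `⊗` is
  -- what lets the joint monicity of the entrywise projections be proved by induction.
  ⊗-equal₁ : ∀ {Γ X X′ Y Y′} {f : X ⇒ X′} {g : Y ⇒ Y′} {h k : Γ ⇒ X × Y} →
             (f ⊗ g) ∘ h ≈ (f ⊗ g) ∘ k → f ∘ π₁ ∘ h ≈ f ∘ π₁ ∘ k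
  ⊗-equal₁ q = ≈-trans (≈-sym π₁-⊗) (≈-trans (∘-congˡ q) π₁-⊗)
    where
    π₁-⊗ : ∀ {Γ X X′ Y Y′} {f : X ⇒ X′} {g : Y ⇒ Y′} {h : Γ ⇒ X × Y} → π₁ ∘ (f ⊗ g) ∘ h ≈ f ∘ π₁ ∘ h
    π₁-⊗ = ≈-trans (∘-congˡ (⟨⟩-∘ _ _ _)) (≈-trans π₁-at (assoc _ _ _))

  ⊗-equal₂ : ∀ {Γ X X′ Y Y′} {f : X ⇒ X′} {g : Y ⇒ Y′} {h k : Γ ⇒ X × Y} →
             (f ⊗ g) ∘ h ≈ (f ⊗ g) ∘ k → g ∘ π₂ ∘ h ≈ g ∘ π₂ ∘ k
  ⊗-equal₂ q = ≈-trans (≈-sym π₂-⊗) (≈-trans (∘-congˡ q) π₂-⊗)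
    where
    π₂-⊗ : ∀ {Γ X X′ Y Y′} {f : X ⇒ X′} {g : Y ⇒ Y′} {h : Γ ⇒ X × Y} → π₂ ∘ (f ⊗ g) ∘ h ≈ g ∘ π₂ ∘ h
    π₂-⊗ = ≈-trans (∘-congˡ (⟨⟩-∘ _ _ _)) (≈-trans π₂-at (assoc _ _ _))

  Δ-at : ∀ {Γ X} {x : Γ ⇒ X} → Δ X ∘ x ≈ ⟨ x , x ⟩
  Δ-at = ⟨⟩-at id-at id-at

  σ-at : ∀ {Γ X Y} {x : Γ ⇒ X} {y : Γ ⇒ Y} → σ X Y ∘ ⟨ x , y ⟩ ≈ ⟨ y , x ⟩
  σ-at = ⟨⟩-at π₂-at π₁-at

  -- f and g agree at the generic element, id.
  ext : ∀ {X Y} {f g : X ⇒ Y} → (∀ {Γ} (x : Γ ⇒ X) → f ∘ x ≈ g ∘ x) → f ≈ g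
  ext q = ≈-trans (≈-sym (identityʳ _)) (≈-trans (q id) (identityʳ _))

  ext₂ : ∀ {X Y Z} {f g : X × Y ⇒ Z} →
         (∀ {Γ} (x : Γ ⇒ X) (y : Γ ⇒ Y) → f ∘ ⟨ x , y ⟩ ≈ g ∘ ⟨ x , y ⟩) → f ≈ g
  ext₂ q = ext (λ x → ≈-trans (∘-congˡ (≈-sym (⟨⟩-η x))) (≈-trans (q _ _) (∘-congˡ (⟨⟩-η x))))

  ext₃ : ∀ {X Y Z W} {f g : (X × Y) × Z ⇒ W} →
         (∀ {Γ} (x : Γ ⇒ X) (y : Γ ⇒ Y) (z : Γ ⇒ Z) → f ∘ ⟨ ⟨ x , y ⟩ , z ⟩ ≈ g ∘ ⟨ ⟨ x , y ⟩ , z ⟩) → f ≈ g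
  ext₃ q = ext₂ (λ x y → let η = ⟨⟩-cong (⟨⟩-η x) ≈-refl in
                         ≈-trans (∘-congˡ (≈-sym η)) (≈-trans (q _ _ _) (∘-congˡ η)))

  ext₄ : ∀ {X Y Z W V} {f g : (X × Y) × (Z × W) ⇒ V} →
         (∀ {Γ} (x : Γ ⇒ X) (y : Γ ⇒ Y) (z : Γ ⇒ Z) (w : Γ ⇒ W) →
           f ∘ ⟨ ⟨ x , y ⟩ , ⟨ z , w ⟩ ⟩ ≈ g ∘ ⟨ ⟨ x , y ⟩ , ⟨ z , w ⟩ ⟩) → f ≈ g
  ext₄ q = ext₂ (λ x y → let η = ⟨⟩-cong (⟨⟩-η x) (⟨⟩-η y) in
                         ≈-trans (∘-congˡ (≈-sym η)) (≈-trans (q _ _ _ _) (∘-congˡ η)))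

  ↑-symˡ : ∀ {X Y} (q : X ≐ Y) → ↑ (≐.sym q) ∘ ↑ q ≈ id
  ↑-symˡ q = ≈-trans (≈-sym (↑-trans _ _)) (↑-id _)

  ↑-symʳ : ∀ {X Y} (q : X ≐ Y) → ↑ q ∘ ↑ (≐.sym q) ≈ id
  ↑-symʳ q = ≈-trans (≈-sym (↑-trans _ _)) (↑-id _)

  ↑-sym-cancel : ∀ {Γ X Y} {q : X ≐ Y} {y : Γ ⇒ Y} → ↑ q ∘ ↑ (≐.sym q) ∘ y ≈ y
  ↑-sym-cancel {q = q} = ≈-trans (≈-sym (assoc _ _ _)) (≈-trans (∘-congʳ (↑-symʳ q)) id-at)

  -- An identification is inverse to the one along the symmetric proof, so any evaluation of `↑ q`
  -- can be read backwards. This evaluates the reversed rebracketings in `δ` and `ζ` without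
  -- formulas for them.
  ↑-sym-at : ∀ {Γ X Y} {q : X ≐ Y} {x : Γ ⇒ X} {y} → ↑ q ∘ x ≈ y → ↑ (≐.sym q) ∘ y ≈ x
  ↑-sym-at {q = q} {x} {y} r = begin
    ↑ (≐.sym q) ∘ y          ≈⟨ ∘-congˡ r ⟨
    ↑ (≐.sym q) ∘ ↑ q ∘ x    ≈⟨ assoc _ _ _ ⟨
    (↑ (≐.sym q) ∘ ↑ q) ∘ x  ≈⟨ ∘-congʳ (↑-symˡ q) ⟩
    id ∘ x                   ≈⟨ identityˡ x ⟩
    x                        ∎

  ↑-trans-at : ∀ {Γ X Y Z} {q : X ≐ Y} {r : Y ≐ Z} {x : Γ ⇒ X} {y z} →
               ↑ q ∘ x ≈ y → ↑ r ∘ y ≈ z → ↑ (≐.trans q r) ∘ x ≈ z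
  ↑-trans-at s t = ≈-trans (∘-congʳ (↑-trans _ _)) (∘-at s t)

  ↑-refl-at : ∀ {Γ X} {q : X ≐ X} {x : Γ ⇒ X} → ↑ q ∘ x ≈ x
  ↑-refl-at = ≈-trans (∘-congʳ (↑-id _)) (identityˡ _)

  ↑-×-at : ∀ {Γ X X′ Y Y′} {q : X ≐ X′} {r : Y ≐ Y′} {x : Γ ⇒ X} {y : Γ ⇒ Y} {x′ y′} →
           ↑ q ∘ x ≈ x′ → ↑ r ∘ y ≈ y′ → ↑ (×-cong q r) ∘ ⟨ x , y ⟩ ≈ ⟨ x′ , y′ ⟩
  ↑-×-at s t = ≈-trans (∘-congʳ (↑-× _ _)) (⊗-at s t)

  ↑-assoc-at : ∀ {Γ X Y Z} {x : Γ ⇒ X} {y : Γ ⇒ Y} {z : Γ ⇒ Z} →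
               ↑ (×-assoc X Y Z) ∘ ⟨ ⟨ x , y ⟩ , z ⟩ ≈ ⟨ x , ⟨ y , z ⟩ ⟩
  ↑-assoc-at = ≈-trans (∘-congʳ (↑-assoc _ _ _))
    (⟨⟩-at (∘-at π₁-at π₁-at) (⟨⟩-at (∘-at π₁-at π₂-at) π₂-at))

  ↑-identityˡ-at : ∀ {Γ X} {x : Γ ⇒ X} {y} → ↑ (×-identityˡ X) ∘ ⟨ y , x ⟩ ≈ x
  ↑-identityˡ-at = ≈-trans (∘-congʳ (↑-identityˡ _)) π₂-at

  ↑-identityʳ-at : ∀ {Γ X} {x : Γ ⇒ X} {y} → ↑ (×-identityʳ X) ∘ ⟨ x , y ⟩ ≈ x
  ↑-identityʳ-at = ≈-trans (∘-congʳ (↑-identityʳ _)) π₁-at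

  rebracket-at : ∀ {Γ V X Y Z} {v : Γ ⇒ V} {x : Γ ⇒ X} {y : Γ ⇒ Y} {z : Γ ⇒ Z} →
                 ↑ (rebracket V X Y Z) ∘ ⟨ ⟨ v , x ⟩ , ⟨ y , z ⟩ ⟩ ≈ ⟨ v , ⟨ ⟨ x , y ⟩ , z ⟩ ⟩
  rebracket-at = ↑-trans-at ↑-assoc-at (↑-×-at ↑-refl-at (↑-sym-at ↑-assoc-at))

  δ-at : ∀ {Γ X Y} {x x′ : Γ ⇒ X} {y y′ : Γ ⇒ Y} →
         δ X Y ∘ ⟨ ⟨ x , y ⟩ , ⟨ x′ , y′ ⟩ ⟩ ≈ ⟨ ⟨ x , x′ ⟩ , ⟨ y , y′ ⟩ ⟩
  δ-at = ∘-at (∘-at rebracket-at (⊗-at id-at (⊗-at σ-at id-at))) (↑-sym-at rebracket-at)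

  α-at : ∀ {Γ X} {x y z : Γ ⇒ X} → α X ∘ ⟨ ⟨ x , y ⟩ , z ⟩ ≈ ⟨ ⟨ x , z ⟩ , ⟨ y , z ⟩ ⟩
  α-at = ∘-at (⊗-at id-at Δ-at) δ-at

-- Left additive structure at generalized elements.

module LeftAdditiveProperties {o p ℓ e} {C : RawLeftAdditiveCategory o p ℓ e} (C-isLeftAdditive : IsLeftAdditiveCategory C) where
  open RawLeftAdditiveCategory C
  open IsLeftAdditiveCategory C-isLeftAdditive
  open CartesianProperties isStrictCartesian public

  infixl 6 _⊹_
  _⊹_ : ∀ {X Y} → X ⇒ Y → X ⇒ Y → X ⇒ Y
  f ⊹ g = +[ _ ] ∘ ⟨ f , g ⟩

  𝟎 : ∀ {X Y} → X ⇒ Y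
  𝟎 = 0[ _ ] ∘ !

  0-at : ∀ {Γ X} {x : Γ ⇒ 𝟙} → 0[ X ] ∘ x ≈ 𝟎
  0-at = ∘-congˡ !-unique₂

  𝟎-at : ∀ {Γ X Y} {x : Γ ⇒ X} → 𝟎 {X} {Y} ∘ x ≈ 𝟎
  𝟎-at = ∘-at ≈-refl 0-at

  0-×-at : ∀ {Γ X Y} {x : Γ ⇒ 𝟙} → 0[ X × Y ] ∘ x ≈ ⟨ 𝟎 , 𝟎 ⟩
  0-×-at = ≈-trans (∘-congʳ (0-× _ _)) (∘-at (↑-sym-at (↑-identityˡ-at {y = !})) (⊗-at 0-at 0-at))

  +-×-at : ∀ {Γ X Y} {x x′ : Γ ⇒ X} {y y′ : Γ ⇒ Y} → ⟨ x , y ⟩ ⊹ ⟨ x′ , y′ ⟩ ≈ ⟨ x ⊹ x′ , y ⊹ y′ ⟩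
  +-×-at = ≈-trans (∘-congʳ (+-× _ _)) (∘-at δ-at (⊗-at ≈-refl ≈-refl))

  ζ-at : ∀ {Γ X} {x y : Γ ⇒ X} → ζ X ∘ ⟨ x , y ⟩ ≈ ⟨ ⟨ x , 𝟎 ⟩ , ⟨ 𝟎 , y ⟩ ⟩
  ζ-at = ∘-at (∘-at (↑-×-at ↑-refl-at (↑-sym-at (↑-identityˡ-at {y = !}))) (⊗-at id-at (⊗-at 0-×-at id-at)))
              (↑-sym-at rebracket-at)

-- The differential axioms at generalized elements, and linear maps.

module DifferentialProperties {o p ℓ e} (C : CartesianDifferentialCategory o p ℓ e) where
  open CartesianDifferentialCategory C
  open LeftAdditiveProperties isLeftAdditiveCategory public
  open HomReasoning

  D-id : ∀ {X} → D (id {X}) ≈ π₁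
  D-id = ext₂ (λ x y → ≈-trans (∘-congʳ (CD1-id _)) (≈-trans (∘-at (⊗-at id-at ≈-refl) ↑-identityʳ-at) (≈-sym π₁-at)))

  linear-at : ∀ {Γ X Y} {f : X ⇒ Y} {ẋ x : Γ ⇒ X} → D f ≈ ↑ (×-identityʳ Y) ∘ (f ⊗ !) → D f ∘ ⟨ ẋ , x ⟩ ≈ f ∘ ẋ
  linear-at q = ≈-trans (∘-congʳ q) (∘-at (⊗-at ≈-refl ≈-refl) ↑-identityʳ-at)

  -- The intermediate tangent and base point are left as premises, so the derivative of a nested
  -- composite is computed from the inside out by nesting uses of this rule.
  D-∘-at : ∀ {Γ X Y Z} {g : Y ⇒ Z} {f : X ⇒ Y} {ẋ x : Γ ⇒ X} {ẏ y ż} →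
           D f ∘ ⟨ ẋ , x ⟩ ≈ ẏ → f ∘ x ≈ y → D g ∘ ⟨ ẏ , y ⟩ ≈ ż → D (g ∘ f) ∘ ⟨ ẋ , x ⟩ ≈ ż
  D-∘-at q r s = ≈-trans (∘-congʳ (CD4 _ _))
    (∘-at (∘-at (∘-at (⊗-at id-at Δ-at) (↑-sym-at ↑-assoc-at)) (⊗-at q r)) s)

  D-⊗-at : ∀ {Γ X X′ Y Y′} {f : X ⇒ X′} {g : Y ⇒ Y′} {ẋ x : Γ ⇒ X} {ẏ y : Γ ⇒ Y} {ẋ′ ẏ′} →
           D f ∘ ⟨ ẋ , x ⟩ ≈ ẋ′ → D g ∘ ⟨ ẏ , y ⟩ ≈ ẏ′ →
           D (f ⊗ g) ∘ ⟨ ⟨ ẋ , ẏ ⟩ , ⟨ x , y ⟩ ⟩ ≈ ⟨ ẋ′ , ẏ′ ⟩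
  D-⊗-at q r = ≈-trans (∘-congʳ (CD5 _ _)) (∘-at δ-at (⊗-at q r))

  D-id-at : ∀ {Γ X} {ẋ x : Γ ⇒ X} → D id ∘ ⟨ ẋ , x ⟩ ≈ ẋ
  D-id-at = ≈-trans (linear-at (CD1-id _)) id-at

  -- `↑ q` is the identity transported along `q` in its codomain, so `D-≐` reduces its derivative to
  -- that of `id`.
  D-↑-at : ∀ {Γ X Y} {q : X ≐ Y} {ẋ x : Γ ⇒ X} → D (↑ q) ∘ ⟨ ẋ , x ⟩ ≈ ↑ q ∘ ẋ
  D-↑-at {q = q} {ẋ} {x} = begin
    D (↑ q) ∘ ⟨ ẋ , x ⟩                                          ≈⟨ ∘-congʳ (D-cong (ext (λ _ → ∘-at (∘-at ↑-refl-at id-at) ≈-refl))) ⟨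
    D (cast ≐.refl q id) ∘ ⟨ ẋ , x ⟩                             ≈⟨ ∘-congʳ (D-≐ ≐.refl q id) ⟩
    cast (×-cong ≐.refl ≐.refl) q (D id) ∘ ⟨ ẋ , x ⟩             ≈⟨ ∘-at (∘-at ↑-refl-at D-id-at) ≈-refl ⟩
    ↑ q ∘ ẋ                                                      ∎

  -- By strictness `π₁` is `id ⊗ !` followed by the right unit identification, so CD4 and CD5 reduce
  -- it to maps whose linearity is already known.
  D-π₁-at : ∀ {Γ X Y} {ẋ x : Γ ⇒ X} {ẏ y : Γ ⇒ Y} → D π₁ ∘ ⟨ ⟨ ẋ , ẏ ⟩ , ⟨ x , y ⟩ ⟩ ≈ ẋ
  D-π₁-at = ≈-trans (∘-congʳ (D-cong (ext₂ (λ x y → ≈-trans π₁-at (≈-sym (∘-at (⊗-at id-at ≈-refl) ↑-identityʳ-at))))))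
    (D-∘-at (D-⊗-at D-id-at (linear-at (CD1-! _))) (⊗-at id-at ≈-refl) (≈-trans D-↑-at ↑-identityʳ-at))

  D-π₂-at : ∀ {Γ X Y} {ẋ x : Γ ⇒ X} {ẏ y : Γ ⇒ Y} → D π₂ ∘ ⟨ ⟨ ẋ , ẏ ⟩ , ⟨ x , y ⟩ ⟩ ≈ ẏ
  D-π₂-at = ≈-trans (∘-congʳ (D-cong (ext₂ (λ x y → ≈-trans π₂-at (≈-sym (∘-at (⊗-at ≈-refl id-at) ↑-identityˡ-at))))))
    (D-∘-at (D-⊗-at (linear-at (CD1-! _)) D-id-at) (⊗-at ≈-refl id-at) (≈-trans D-↑-at ↑-identityˡ-at))

  -- A pairing is `(f ⊗ g) ∘ Δ` with `Δ` linear, so CD5 and the chain rule apply.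
  D-⟨⟩-at : ∀ {Γ X Y Z} {f : X ⇒ Y} {g : X ⇒ Z} {ẋ x : Γ ⇒ X} {ẏ ż} →
            D f ∘ ⟨ ẋ , x ⟩ ≈ ẏ → D g ∘ ⟨ ẋ , x ⟩ ≈ ż → D ⟨ f , g ⟩ ∘ ⟨ ẋ , x ⟩ ≈ ⟨ ẏ , ż ⟩
  D-⟨⟩-at q r = ≈-trans (∘-congʳ (D-cong (ext (λ x → ≈-trans (⟨⟩-at ≈-refl ≈-refl) (≈-sym (∘-at Δ-at (⊗-at ≈-refl ≈-refl)))))))
    (D-∘-at (≈-trans (linear-at (CD1-Δ _)) Δ-at) Δ-at (D-⊗-at q r))

  D-𝟎-at : ∀ {Γ X Y} {f : X ⇒ Y} {x : Γ ⇒ X} → D f ∘ ⟨ 𝟎 , x ⟩ ≈ 𝟎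
  D-𝟎-at = ≈-trans (∘-congˡ (≈-sym (⊗-at ≈-refl id-at))) (≈-trans (≈-sym (assoc _ _ _)) (≈-trans (∘-congʳ (CD2 _)) 𝟎-at))

  D-⊹-at : ∀ {Γ X Y} {f : X ⇒ Y} {ẋ ẏ x : Γ ⇒ X} → D f ∘ ⟨ ẋ ⊹ ẏ , x ⟩ ≈ D f ∘ ⟨ ẋ , x ⟩ ⊹ D f ∘ ⟨ ẏ , x ⟩
  D-⊹-at = ≈-trans (∘-congˡ (≈-sym (⊗-at ≈-refl id-at))) (≈-trans (≈-sym (assoc _ _ _)) (≈-trans (∘-congʳ (CD3 _))
    (∘-at (∘-at α-at (⊗-at ≈-refl ≈-refl)) ≈-refl)))

  DD-ζ-at : ∀ {Γ X Y} {f : X ⇒ Y} {ẋ x : Γ ⇒ X} → D (D f) ∘ ⟨ ⟨ ẋ , 𝟎 ⟩ , ⟨ 𝟎 , x ⟩ ⟩ ≈ D f ∘ ⟨ ẋ , x ⟩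
  DD-ζ-at = ≈-trans (≈-sym (∘-at ζ-at ≈-refl)) (∘-congʳ (CD6 _))

  DD-δ-at : ∀ {Γ X Y} {f : X ⇒ Y} {x y z w : Γ ⇒ X} →
            D (D f) ∘ ⟨ ⟨ x , z ⟩ , ⟨ y , w ⟩ ⟩ ≈ D (D f) ∘ ⟨ ⟨ x , y ⟩ , ⟨ z , w ⟩ ⟩
  DD-δ-at = ≈-trans (≈-sym (∘-at δ-at ≈-refl)) (∘-congʳ (CD7 _))

  -- Agrees with Linear up to the strict identification Y × 𝟙 ≐ Y.
  IsLinear : ∀ {X Y} → X ⇒ Y → Set e
  IsLinear f = D f ≈ f ∘ π₁

  IsLinear-at : ∀ {Γ X Y} {f : X ⇒ Y} {ẋ x : Γ ⇒ X} → IsLinear f → D f ∘ ⟨ ẋ , x ⟩ ≈ f ∘ ẋ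
  IsLinear-at q = ≈-trans (∘-congʳ q) (∘-at π₁-at ≈-refl)

  linear : ∀ {X Y} {f : X ⇒ Y} → (∀ {Γ} {ẋ x : Γ ⇒ X} → D f ∘ ⟨ ẋ , x ⟩ ≈ f ∘ ẋ) → IsLinear f
  linear q = ext₂ (λ _ _ → ≈-trans q (≈-sym (∘-at π₁-at ≈-refl)))

  IsLinear-resp : ∀ {X Y} {f g : X ⇒ Y} → f ≈ g → IsLinear g → IsLinear f
  IsLinear-resp q r = ≈-trans (D-cong q) (≈-trans r (∘-congʳ (≈-sym q)))

  -- In the chain rule the derivative of a linear `g` ignores its base point. This is how product
  -- comparisons and projections are moved through `D`.
  D-linear-∘ : ∀ {X Y Z} {g : Y ⇒ Z} {f : X ⇒ Y} → IsLinear g → D (g ∘ f) ≈ g ∘ D f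
  D-linear-∘ q = ext₂ (λ _ _ → ≈-trans (D-∘-at ≈-refl ≈-refl (IsLinear-at q)) (≈-sym (assoc _ _ _)))

  id-linear : ∀ {X} → IsLinear (id {X})
  id-linear = ≈-trans D-id (≈-sym id-at)

  π₁-linear : ∀ {X Y} → IsLinear (π₁ {X} {Y})
  π₁-linear = ext₄ (λ _ _ _ _ → ≈-trans D-π₁-at (≈-sym (∘-at π₁-at π₁-at)))

  π₂-linear : ∀ {X Y} → IsLinear (π₂ {X} {Y})
  π₂-linear = ext₄ (λ _ _ _ _ → ≈-trans D-π₂-at (≈-sym (∘-at π₁-at π₂-at)))

  ↑-linear : ∀ {X Y} {q : X ≐ Y} → IsLinear (↑ q)
  ↑-linear = linear D-↑-at

  +-linear : ∀ {X} → IsLinear +[ X ]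
  +-linear = linear (linear-at (CD1-+ _))

  ∘-linear : ∀ {X Y Z} {g : Y ⇒ Z} {f : X ⇒ Y} → IsLinear g → IsLinear f → IsLinear (g ∘ f)
  ∘-linear q r = linear (≈-trans (D-∘-at (IsLinear-at r) ≈-refl (IsLinear-at q)) (≈-sym (assoc _ _ _)))

  ⟨⟩-linear : ∀ {X Y Z} {f : X ⇒ Y} {g : X ⇒ Z} → IsLinear f → IsLinear g → IsLinear ⟨ f , g ⟩
  ⟨⟩-linear q r = linear (≈-trans (D-⟨⟩-at (IsLinear-at q) (IsLinear-at r)) (≈-sym (⟨⟩-∘ _ _ _)))

  𝟎-linear : ∀ {X Y} → IsLinear (𝟎 {X} {Y})
  𝟎-linear = linear (≈-trans (D-∘-at {ẏ = !} !-unique₂ ≈-refl (linear-at (CD1-0 _))) (≈-sym 𝟎-at))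

  ⊗-linear : ∀ {X X′ Y Y′} {f : X ⇒ X′} {g : Y ⇒ Y′} → IsLinear f → IsLinear g → IsLinear (f ⊗ g)
  ⊗-linear q r = ⟨⟩-linear (∘-linear q π₁-linear) (∘-linear r π₂-linear)

-- Families of functors that reflect differential structure.

module _ {o p ℓ e o′ p′ ℓ′ e′} (A : RawLeftAdditiveCategory o p ℓ e) (C : CartesianDifferentialCategory o′ p′ ℓ′ e′) where
  private
    module 𝔸 = RawLeftAdditiveCategory A
  open CartesianDifferentialCategory C
  open DifferentialProperties C using (𝟎; IsLinear)

  -- Of product preservation only the joint monicity of the projections is
  -- needed (F-𝟙, F-×).
  record JointlyFaithfulDifferentialFunctors {i} (I : Set i) (𝒟 : ∀ {X Y} → X 𝔸.⇒ Y → X 𝔸.× X 𝔸.⇒ Y) : Set (i ⊔ o ⊔ p ⊔ ℓ ⊔ e ⊔ o′ ⊔ p′ ⊔ ℓ′ ⊔ e′) where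
    field
      F₀       : I → 𝔸.Obj → Obj
      F        : ∀ n {X Y} → X 𝔸.⇒ Y → F₀ n X ⇒ F₀ n Y
      F-cong   : ∀ n {X Y} {f g : X 𝔸.⇒ Y} → f 𝔸.≈ g → F n f ≈ F n g
      faithful : ∀ {X Y} {f g : X 𝔸.⇒ Y} → (∀ n → F n f ≈ F n g) → f 𝔸.≈ g
      F-id     : ∀ n {X} → F n (𝔸.id {X}) ≈ id
      F-∘      : ∀ n {X Y Z} (g : Y 𝔸.⇒ Z) (f : X 𝔸.⇒ Y) → F n (g 𝔸.∘ f) ≈ F n g ∘ F n f
      F-𝟙      : ∀ n {X} {f g : X ⇒ F₀ n 𝔸.𝟙} → f ≈ g
      F-×      : ∀ n {W X Y} {f g : W ⇒ F₀ n (X 𝔸.× Y)} →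
                 F n 𝔸.π₁ ∘ f ≈ F n 𝔸.π₁ ∘ g → F n 𝔸.π₂ ∘ f ≈ F n 𝔸.π₂ ∘ g → f ≈ g
      F-+      : ∀ n X → F n 𝔸.+[ X ] ≈ +[ F₀ n X ] ∘ ⟨ F n 𝔸.π₁ , F n 𝔸.π₂ ⟩
      F-0      : ∀ n X → F n 𝔸.0[ X ] ≈ 𝟎
      F-↑      : ∀ n {X Y} (q : X 𝔸.≐ Y) → IsLinear (F n (𝔸.↑ q))
      F-π₁     : ∀ n {X Y} → IsLinear (F n (𝔸.π₁ {X} {Y}))
      F-π₂     : ∀ n {X Y} → IsLinear (F n (𝔸.π₂ {X} {Y}))
      F-𝒟      : ∀ n {X Y} (f : X 𝔸.⇒ Y) → F n (𝒟 f) ≈ D (F n f) ∘ ⟨ F n 𝔸.π₁ , F n 𝔸.π₂ ⟩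

-- Reflection of the axioms along such a family.

module _ {o p ℓ e o′ p′ ℓ′ e′} {A : RawLeftAdditiveCategory o p ℓ e} {C : CartesianDifferentialCategory o′ p′ ℓ′ e′}
         (A-isLeftAdditive : IsLeftAdditiveCategory A) where
  private
    module 𝔸 where
      open RawLeftAdditiveCategory A public
      open IsLeftAdditiveCategory A-isLeftAdditive public
      open LeftAdditiveProperties A-isLeftAdditive public
  open CartesianDifferentialCategory C
  open DifferentialProperties C
  open HomReasoning

  module DifferentialReflection {i} {I : Set i} {𝒟 : ∀ {X Y} → X 𝔸.⇒ Y → X 𝔸.× X 𝔸.⇒ Y}
                                (functors : JointlyFaithfulDifferentialFunctors A C I 𝒟) where
    open JointlyFaithfulDifferentialFunctors functors

    -- The canonical comparison from the image of a product to the product of the images; for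
    -- truncations it is `unzip`.
    split : ∀ n X Y → F₀ n (X 𝔸.× Y) ⇒ F₀ n X × F₀ n Y
    split n X Y = ⟨ F n 𝔸.π₁ , F n 𝔸.π₂ ⟩

    split-linear : ∀ n {X Y} → IsLinear (split n X Y)
    split-linear n = ⟨⟩-linear (F-π₁ n) (F-π₂ n)

    split-⟨⟩ : ∀ n {X Y Z} (f : X 𝔸.⇒ Y) (g : X 𝔸.⇒ Z) → split n Y Z ∘ F n 𝔸.⟨ f , g ⟩ ≈ ⟨ F n f , F n g ⟩
    split-⟨⟩ n f g = ⟨⟩-at (≈-trans (≈-sym (F-∘ n _ _)) (F-cong n 𝔸.π₁-at))
                           (≈-trans (≈-sym (F-∘ n _ _)) (F-cong n 𝔸.π₂-at))

    split-monic : ∀ n {W X Y} {f g : W ⇒ F₀ n (X 𝔸.× Y)} → split n X Y ∘ f ≈ split n X Y ∘ g → f ≈ g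
    split-monic n q = F-× n (component π₁-at q) (component π₂-at q)
      where
      component : ∀ {V W X Y} {u : V ⇒ X} {v : V ⇒ Y} {w : X ⇒ Y} {f g : W ⇒ V} →
                  w ∘ u ≈ v → u ∘ f ≈ u ∘ g → v ∘ f ≈ v ∘ g
      component r s = ≈-trans (∘-congʳ (≈-sym r)) (≈-trans (∘-at s (≈-sym (assoc _ _ _))) (∘-congʳ r))

    split-⊗ : ∀ n {X Y V W} (f : X 𝔸.⇒ Y) (h : V 𝔸.⇒ W) →
              split n Y W ∘ F n (f 𝔸.⊗ h) ≈ (F n f ⊗ F n h) ∘ split n X V
    split-⊗ n f h = ≈-trans (split-⟨⟩ n _ _)
      (≈-trans (⟨⟩-cong (F-∘ n f _) (F-∘ n h _)) (≈-sym (⊗-at ≈-refl ≈-refl)))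

    -- `split` is linear and monic, so linearity can be tested after it, where the image of a
    -- pairing becomes a pairing of linear maps.
    F-⟨⟩-linear : ∀ n {X Y Z} {f : X 𝔸.⇒ Y} {g : X 𝔸.⇒ Z} → IsLinear (F n f) → IsLinear (F n g) → IsLinear (F n 𝔸.⟨ f , g ⟩)
    F-⟨⟩-linear n {f = f} {g} q r = split-monic n (begin
      split n _ _ ∘ D (F n 𝔸.⟨ f , g ⟩)      ≈⟨ D-linear-∘ (split-linear n) ⟨
      D (split n _ _ ∘ F n 𝔸.⟨ f , g ⟩)      ≈⟨ IsLinear-resp (split-⟨⟩ n f g) (⟨⟩-linear q r) ⟩
      (split n _ _ ∘ F n 𝔸.⟨ f , g ⟩) ∘ π₁   ≈⟨ assoc _ _ _ ⟩
      split n _ _ ∘ F n 𝔸.⟨ f , g ⟩ ∘ π₁     ∎)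

    F-⊹ : ∀ n {X Y} (f g : X 𝔸.⇒ Y) → F n (f 𝔸.⊹ g) ≈ F n f ⊹ F n g
    F-⊹ n f g = ≈-trans (F-∘ n _ _) (≈-trans (∘-congʳ (F-+ n _)) (∘-at (split-⟨⟩ n f g) ≈-refl))

    F-𝟎 : ∀ n {X Y} → F n (𝔸.𝟎 {X} {Y}) ≈ 𝟎
    F-𝟎 n = ≈-trans (F-∘ n _ _) (≈-trans (∘-congʳ (F-0 n _)) 𝟎-at)

    F-𝒟-at : ∀ n {Γ X Y} {f : X 𝔸.⇒ Y} {ẋ x : Γ 𝔸.⇒ X} → F n (𝒟 f 𝔸.∘ 𝔸.⟨ ẋ , x ⟩) ≈ D (F n f) ∘ ⟨ F n ẋ , F n x ⟩
    F-𝒟-at n = ≈-trans (F-∘ n _ _) (≈-trans (∘-congʳ (F-𝒟 n _)) (∘-at (split-⟨⟩ n _ _) ≈-refl))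

    -- Using `F-𝒟` a second time puts `split` under the outer `D`. Because `split` is linear, the
    -- chain rule applies it separately to the tangent and to the base point.
    F-𝒟𝒟-at : ∀ n {Γ X Y} {f : X 𝔸.⇒ Y} {x y z w : Γ 𝔸.⇒ X} →
              F n (𝒟 (𝒟 f) 𝔸.∘ 𝔸.⟨ 𝔸.⟨ x , y ⟩ , 𝔸.⟨ z , w ⟩ ⟩) ≈ D (D (F n f)) ∘ ⟨ ⟨ F n x , F n y ⟩ , ⟨ F n z , F n w ⟩ ⟩
    F-𝒟𝒟-at n {f = f} {x} {y} {z} {w} = begin
      F n (𝒟 (𝒟 f) 𝔸.∘ 𝔸.⟨ 𝔸.⟨ x , y ⟩ , 𝔸.⟨ z , w ⟩ ⟩)
        ≈⟨ F-𝒟-at n ⟩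
      D (F n (𝒟 f)) ∘ ⟨ F n 𝔸.⟨ x , y ⟩ , F n 𝔸.⟨ z , w ⟩ ⟩
        ≈⟨ ∘-congʳ (D-cong (F-𝒟 n f)) ⟩
      D (D (F n f) ∘ split n _ _) ∘ ⟨ F n 𝔸.⟨ x , y ⟩ , F n 𝔸.⟨ z , w ⟩ ⟩
        ≈⟨ D-∘-at (≈-trans (IsLinear-at (split-linear n)) (split-⟨⟩ n x y)) (split-⟨⟩ n z w) ≈-refl ⟩
      D (D (F n f)) ∘ ⟨ ⟨ F n x , F n y ⟩ , ⟨ F n z , F n w ⟩ ⟩ ∎

    𝒟-linear-at : ∀ {Γ X Y} {s : X 𝔸.⇒ Y} {ẋ x : Γ 𝔸.⇒ X} → (∀ n → IsLinear (F n s)) → 𝒟 s 𝔸.∘ 𝔸.⟨ ẋ , x ⟩ 𝔸.≈ s 𝔸.∘ ẋ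
    𝒟-linear-at q = faithful (λ n → ≈-trans (F-𝒟-at n) (≈-trans (IsLinear-at (q n)) (≈-sym (F-∘ n _ _))))

    𝒟-linear : ∀ {X Y} {s : X 𝔸.⇒ Y} → (∀ n → IsLinear (F n s)) → 𝒟 s 𝔸.≈ 𝔸.↑ (𝔸.×-identityʳ Y) 𝔸.∘ (s 𝔸.⊗ 𝔸.!)
    𝒟-linear q = 𝔸.ext₂ (λ _ _ → 𝔸.≈-trans (𝒟-linear-at q) (𝔸.≈-sym (𝔸.∘-at (𝔸.⊗-at 𝔸.≈-refl 𝔸.≈-refl) 𝔸.↑-identityʳ-at)))

    𝒟-∘-at : ∀ {Γ X Y Z} {g : Y 𝔸.⇒ Z} {f : X 𝔸.⇒ Y} {ẋ x : Γ 𝔸.⇒ X} →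
             𝒟 (g 𝔸.∘ f) 𝔸.∘ 𝔸.⟨ ẋ , x ⟩ 𝔸.≈ 𝒟 g 𝔸.∘ 𝔸.⟨ 𝒟 f 𝔸.∘ 𝔸.⟨ ẋ , x ⟩ , f 𝔸.∘ x ⟩
    𝒟-∘-at {g = g} {f} {ẋ} {x} = faithful (λ n → begin
      F n (𝒟 (g 𝔸.∘ f) 𝔸.∘ 𝔸.⟨ ẋ , x ⟩)                           ≈⟨ F-𝒟-at n ⟩
      D (F n (g 𝔸.∘ f)) ∘ ⟨ F n ẋ , F n x ⟩                       ≈⟨ ∘-congʳ (D-cong (F-∘ n g f)) ⟩
      D (F n g ∘ F n f) ∘ ⟨ F n ẋ , F n x ⟩                       ≈⟨ D-∘-at (≈-sym (F-𝒟-at n)) (≈-sym (F-∘ n f x)) ≈-refl ⟩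
      D (F n g) ∘ ⟨ F n (𝒟 f 𝔸.∘ 𝔸.⟨ ẋ , x ⟩) , F n (f 𝔸.∘ x) ⟩   ≈⟨ F-𝒟-at n ⟨
      F n (𝒟 g 𝔸.∘ 𝔸.⟨ 𝒟 f 𝔸.∘ 𝔸.⟨ ẋ , x ⟩ , f 𝔸.∘ x ⟩)           ∎)

    -- A cast is composition on both sides with identifications. Their images are linear, so the
    -- chain rule lets them pass through `𝒟`.
    𝒟-≐ : ∀ {X X′ Y Y′} (q : X 𝔸.≐ X′) (r : Y 𝔸.≐ Y′) (f : X 𝔸.⇒ Y) →
          𝒟 (𝔸.cast q r f) 𝔸.≈ 𝔸.cast (𝔸.×-cong q q) r (𝒟 f)
    𝒟-≐ q r f = 𝔸.ext₂ (λ ẋ x → 𝔸.≈-trans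
      (𝔸.≈-trans 𝒟-∘-at (𝒟-linear-at (λ n → F-↑ n r)))
      (𝔸.≈-trans (𝔸.∘-congˡ (𝔸.≈-trans 𝒟-∘-at (𝔸.∘-congˡ (𝔸.⟨⟩-cong (𝒟-linear-at (λ n → F-↑ n _)) 𝔸.≈-refl))))
        (𝔸.≈-sym (𝔸.∘-at (𝔸.∘-at (𝔸.↑-sym-at (𝔸.↑-×-at 𝔸.↑-sym-cancel 𝔸.↑-sym-cancel)) 𝔸.≈-refl) 𝔸.≈-refl))))

    𝒟-𝟎-at : ∀ {Γ X Y} {f : X 𝔸.⇒ Y} {x : Γ 𝔸.⇒ X} → 𝒟 f 𝔸.∘ 𝔸.⟨ 𝔸.𝟎 , x ⟩ 𝔸.≈ 𝔸.𝟎
    𝒟-𝟎-at = faithful (λ n → ≈-trans (F-𝒟-at n)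
      (≈-trans (∘-congˡ (⟨⟩-cong (F-𝟎 n) ≈-refl)) (≈-trans D-𝟎-at (≈-sym (F-𝟎 n)))))

    𝒟-⊹-at : ∀ {Γ X Y} {f : X 𝔸.⇒ Y} {ẋ ẏ x : Γ 𝔸.⇒ X} →
             𝒟 f 𝔸.∘ 𝔸.⟨ ẋ 𝔸.⊹ ẏ , x ⟩ 𝔸.≈ 𝒟 f 𝔸.∘ 𝔸.⟨ ẋ , x ⟩ 𝔸.⊹ 𝒟 f 𝔸.∘ 𝔸.⟨ ẏ , x ⟩
    𝒟-⊹-at {f = f} {ẋ} {ẏ} {x} = faithful (λ n → begin
      F n (𝒟 f 𝔸.∘ 𝔸.⟨ ẋ 𝔸.⊹ ẏ , x ⟩)                                   ≈⟨ F-𝒟-at n ⟩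
      D (F n f) ∘ ⟨ F n (ẋ 𝔸.⊹ ẏ) , F n x ⟩                             ≈⟨ ∘-congˡ (⟨⟩-cong (F-⊹ n ẋ ẏ) ≈-refl) ⟩
      D (F n f) ∘ ⟨ F n ẋ ⊹ F n ẏ , F n x ⟩                             ≈⟨ D-⊹-at ⟩
      D (F n f) ∘ ⟨ F n ẋ , F n x ⟩ ⊹ D (F n f) ∘ ⟨ F n ẏ , F n x ⟩     ≈⟨ ∘-congˡ (⟨⟩-cong (F-𝒟-at n) (F-𝒟-at n)) ⟨
      F n (𝒟 f 𝔸.∘ 𝔸.⟨ ẋ , x ⟩) ⊹ F n (𝒟 f 𝔸.∘ 𝔸.⟨ ẏ , x ⟩)             ≈⟨ F-⊹ n _ _ ⟨
      F n (𝒟 f 𝔸.∘ 𝔸.⟨ ẋ , x ⟩ 𝔸.⊹ 𝒟 f 𝔸.∘ 𝔸.⟨ ẏ , x ⟩)                 ∎)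

    -- Both sides land in the image of a product, so they are compared after `split`. Its linearity
    -- carries it inside `D`, where it turns the image of `f ⊗ h` into a genuine `⊗` to which CD5
    -- applies.
    𝒟-⊗-at : ∀ {Γ X Y V W} {f : X 𝔸.⇒ Y} {h : V 𝔸.⇒ W} {ẋ x : Γ 𝔸.⇒ X} {v̇ v : Γ 𝔸.⇒ V} →
             𝒟 (f 𝔸.⊗ h) 𝔸.∘ 𝔸.⟨ 𝔸.⟨ ẋ , v̇ ⟩ , 𝔸.⟨ x , v ⟩ ⟩ 𝔸.≈ 𝔸.⟨ 𝒟 f 𝔸.∘ 𝔸.⟨ ẋ , x ⟩ , 𝒟 h 𝔸.∘ 𝔸.⟨ v̇ , v ⟩ ⟩
    𝒟-⊗-at {f = f} {h} {ẋ} {x} {v̇} {v} = faithful (λ n → split-monic n (begin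
      split n _ _ ∘ F n (𝒟 (f 𝔸.⊗ h) 𝔸.∘ 𝔸.⟨ 𝔸.⟨ ẋ , v̇ ⟩ , 𝔸.⟨ x , v ⟩ ⟩)
        ≈⟨ ∘-congˡ (F-𝒟-at n) ⟩
      split n _ _ ∘ D (F n (f 𝔸.⊗ h)) ∘ ⟨ F n 𝔸.⟨ ẋ , v̇ ⟩ , F n 𝔸.⟨ x , v ⟩ ⟩
        ≈⟨ ∘-at ≈-refl ≈-refl ⟨
      (split n _ _ ∘ D (F n (f 𝔸.⊗ h))) ∘ ⟨ F n 𝔸.⟨ ẋ , v̇ ⟩ , F n 𝔸.⟨ x , v ⟩ ⟩
        ≈⟨ ∘-congʳ (≈-trans (≈-sym (D-linear-∘ (split-linear n))) (D-cong (split-⊗ n f h))) ⟩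
      D ((F n f ⊗ F n h) ∘ split n _ _) ∘ ⟨ F n 𝔸.⟨ ẋ , v̇ ⟩ , F n 𝔸.⟨ x , v ⟩ ⟩
        ≈⟨ D-∘-at (≈-trans (IsLinear-at (split-linear n)) (split-⟨⟩ n ẋ v̇)) (split-⟨⟩ n x v)
                  (D-⊗-at (≈-sym (F-𝒟-at n)) (≈-sym (F-𝒟-at n))) ⟩
      ⟨ F n (𝒟 f 𝔸.∘ 𝔸.⟨ ẋ , x ⟩) , F n (𝒟 h 𝔸.∘ 𝔸.⟨ v̇ , v ⟩) ⟩
        ≈⟨ split-⟨⟩ n _ _ ⟨
      split n _ _ ∘ F n 𝔸.⟨ 𝒟 f 𝔸.∘ 𝔸.⟨ ẋ , x ⟩ , 𝒟 h 𝔸.∘ 𝔸.⟨ v̇ , v ⟩ ⟩ ∎))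

    𝒟𝒟-ζ-at : ∀ {Γ X Y} {f : X 𝔸.⇒ Y} {ẋ x : Γ 𝔸.⇒ X} →
              𝒟 (𝒟 f) 𝔸.∘ 𝔸.⟨ 𝔸.⟨ ẋ , 𝔸.𝟎 ⟩ , 𝔸.⟨ 𝔸.𝟎 , x ⟩ ⟩ 𝔸.≈ 𝒟 f 𝔸.∘ 𝔸.⟨ ẋ , x ⟩
    𝒟𝒟-ζ-at = faithful (λ n → ≈-trans (F-𝒟𝒟-at n)
      (≈-trans (∘-congˡ (⟨⟩-cong (⟨⟩-cong ≈-refl (F-𝟎 n)) (⟨⟩-cong (F-𝟎 n) ≈-refl)))
        (≈-trans DD-ζ-at (≈-sym (F-𝒟-at n)))))

    𝒟𝒟-δ-at : ∀ {Γ X Y} {f : X 𝔸.⇒ Y} {x y z w : Γ 𝔸.⇒ X} →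
              𝒟 (𝒟 f) 𝔸.∘ 𝔸.⟨ 𝔸.⟨ x , z ⟩ , 𝔸.⟨ y , w ⟩ ⟩ 𝔸.≈ 𝒟 (𝒟 f) 𝔸.∘ 𝔸.⟨ 𝔸.⟨ x , y ⟩ , 𝔸.⟨ z , w ⟩ ⟩
    𝒟𝒟-δ-at = faithful (λ n → ≈-trans (F-𝒟𝒟-at n) (≈-trans DD-δ-at (≈-sym (F-𝒟𝒟-at n))))

    reflects : IsCartesianDifferentialCategory A 𝒟
    reflects = record
      { isLeftAdditiveCategory          = A-isLeftAdditive
      ; isCartesianDifferentialOperator = record
        { D-cong = λ q → faithful (λ n → ≈-trans (F-𝒟 n _) (≈-trans (∘-congʳ (D-cong (F-cong n q))) (≈-sym (F-𝒟 n _))))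
        ; D-≐    = 𝒟-≐
        ; CD1-id = λ X → 𝒟-linear (λ n → IsLinear-resp (F-id n) id-linear)
        ; CD1-σ  = λ X Y → 𝒟-linear (λ n → F-⟨⟩-linear n (F-π₂ n) (F-π₁ n))
        -- Linearity is itself an equation between maps into the image of the terminal object, so
        -- `F-𝟙` proves it outright.
        ; CD1-!  = λ X → 𝒟-linear (λ n → F-𝟙 n)
        ; CD1-Δ  = λ X → 𝒟-linear (λ n → F-⟨⟩-linear n (IsLinear-resp (F-id n) id-linear) (IsLinear-resp (F-id n) id-linear))
        ; CD1-+  = λ X → 𝒟-linear (λ n → IsLinear-resp (F-+ n X) (∘-linear +-linear (split-linear n)))
        ; CD1-0  = λ X → 𝒟-linear (λ n → IsLinear-resp (F-0 n X) 𝟎-linear)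
        ; CD2    = λ f → 𝔸.ext₂ (λ _ _ → 𝔸.≈-trans (𝔸.∘-at (𝔸.⊗-at 𝔸.0-at 𝔸.id-at) 𝒟-𝟎-at) (𝔸.≈-sym 𝔸.𝟎-at))
        ; CD3    = λ f → 𝔸.ext₃ (λ _ _ _ → 𝔸.≈-trans (𝔸.∘-at (𝔸.⊗-at 𝔸.≈-refl 𝔸.id-at) 𝒟-⊹-at)
            (𝔸.≈-sym (𝔸.∘-at (𝔸.∘-at 𝔸.α-at (𝔸.⊗-at 𝔸.≈-refl 𝔸.≈-refl)) 𝔸.≈-refl)))
        ; CD4    = λ f g → 𝔸.ext₂ (λ _ _ → 𝔸.≈-trans 𝒟-∘-at
            (𝔸.≈-sym (𝔸.∘-at (𝔸.∘-at (𝔸.∘-at (𝔸.⊗-at 𝔸.id-at 𝔸.Δ-at) (𝔸.↑-sym-at 𝔸.↑-assoc-at)) (𝔸.⊗-at 𝔸.≈-refl 𝔸.≈-refl)) 𝔸.≈-refl)))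
        ; CD5    = λ f h → 𝔸.ext₄ (λ _ _ _ _ → 𝔸.≈-trans 𝒟-⊗-at (𝔸.≈-sym (𝔸.∘-at 𝔸.δ-at (𝔸.⊗-at 𝔸.≈-refl 𝔸.≈-refl))))
        ; CD6    = λ f → 𝔸.ext₂ (λ _ _ → 𝔸.∘-at 𝔸.ζ-at 𝒟𝒟-ζ-at)
        ; CD7    = λ f → 𝔸.ext₄ (λ _ _ _ _ → 𝔸.∘-at 𝔸.δ-at 𝒟𝒟-δ-at)
        }
      }

-- Truncations as functors, and the strict Cartesian structure of `St`.

module StatefulProperties {o p ℓ e} {C : RawLeftAdditiveCategory o p ℓ e} (C-isStrictCartesian : IsStrictCartesian C) where
  open RawLeftAdditiveCategory C
  open IsStrictCartesian C-isStrictCartesian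
  open CartesianProperties C-isStrictCartesian
  open HomReasoning
  open Stateful C

  ʰ-at : ∀ {Γ X Y} {φ : X ⇒ Y} {s : Γ ⇒ 𝟙} {x : Γ ⇒ X} → U (φ ʰ) ∘ ⟨ s , x ⟩ ≈ ⟨ ! , φ ∘ x ⟩
  ʰ-at = ∘-at (∘-at (↑-sym-at (↑-sym-at ↑-identityˡ-at)) ≈-refl) (↑-sym-at ↑-identityˡ-at)

  ᵛ-at : ∀ {Γ X Y} {φ : X ⇒ Y} {s : Γ ⇒ 𝟙} {x : Γ ⇒ X} → U (φ ᵛ) ∘ ⟨ x , s ⟩ ≈ ⟨ φ ∘ x , ! ⟩
  ᵛ-at = ∘-at (∘-at (↑-sym-at (↑-sym-at ↑-identityʳ-at)) ≈-refl) (↑-sym-at ↑-identityʳ-at)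

  ✶-at : ∀ {Γ S S′ T T′ X Y Z} {g : TwoCell T Y T′ Z} {f : TwoCell S X S′ Y}
         {s : Γ ⇒ S} {t : Γ ⇒ T} {x : Γ ⇒ X} {s′ y t′ z} →
         U f ∘ ⟨ s , x ⟩ ≈ ⟨ s′ , y ⟩ → U g ∘ ⟨ t , y ⟩ ≈ ⟨ t′ , z ⟩ →
         U (g ✶ f) ∘ ⟨ ⟨ s , t ⟩ , x ⟩ ≈ ⟨ ⟨ s′ , t′ ⟩ , z ⟩
  ✶-at {s = s} {t} {x} {s′} {y} {t′} {z} q r = ⟨⟩-at (⟨⟩-at (∘-at s′y π₁-at) (∘-at t′z π₁-at)) (∘-at t′z π₂-at)
    where
    s′y : _ ∘ ⟨ ⟨ s , t ⟩ , x ⟩ ≈ ⟨ s′ , y ⟩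
    s′y = ∘-at (⟨⟩-at (∘-at π₁-at π₁-at) π₂-at) q
    t′z : _ ∘ ⟨ ⟨ s , t ⟩ , x ⟩ ≈ ⟨ t′ , z ⟩
    t′z = ∘-at (⟨⟩-at (∘-at π₁-at π₂-at) (∘-at s′y π₂-at)) r

  ⨾-at : ∀ {Γ S S′ S″ X Y V W} {f : TwoCell S X S′ Y} {h : TwoCell S′ V S″ W}
         {s : Γ ⇒ S} {x : Γ ⇒ X} {v : Γ ⇒ V} {s′ y s″ w} →
         U f ∘ ⟨ s , x ⟩ ≈ ⟨ s′ , y ⟩ → U h ∘ ⟨ s′ , v ⟩ ≈ ⟨ s″ , w ⟩ →
         U (f ⨾ h) ∘ ⟨ s , ⟨ x , v ⟩ ⟩ ≈ ⟨ s″ , ⟨ y , w ⟩ ⟩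
  ⨾-at {s = s} {x} {v} {s′} {y} {s″} {w} q r = ⟨⟩-at (∘-at s″w π₁-at) (⟨⟩-at (∘-at s′y π₂-at) (∘-at s″w π₂-at))
    where
    s′y : _ ∘ ⟨ s , ⟨ x , v ⟩ ⟩ ≈ ⟨ s′ , y ⟩
    s′y = ∘-at (⟨⟩-at π₁-at (∘-at π₂-at π₁-at)) q
    s″w : _ ∘ ⟨ s , ⟨ x , v ⟩ ⟩ ≈ ⟨ s″ , w ⟩
    s″w = ∘-at (⟨⟩-at (∘-at s′y π₁-at) (∘-at π₂-at π₂-at)) r

  mutual
    -- The state reached after `n` inputs, with the initial state absorbed. Truncations hide it, but
    -- the next output depends on it, so inductions over `n` have to follow it.
    stateAt : ∀ {X Y} (f : StatefulSequence X Y) n → ∏ n X ⇒ state f n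
    stateAt f zero    = init f
    stateAt f (suc n) = π₁ ∘ stepAt f n

    stepAt : ∀ {X Y} (f : StatefulSequence X Y) n → ∏ (suc n) X ⇒ state f (suc n) × Y n
    stepAt f n = U (cells f n) ∘ ⟨ stateAt f n ∘ π₁ , π₂ ⟩

  -- trace f n is the map from the first n inputs to the first n outputs, so
  -- that Tc n is trace at suc n.
  trace : ∀ {X Y} (f : StatefulSequence X Y) n → ∏ n X ⇒ ∏ n Y
  trace f zero    = id
  trace f (suc n) = ⟨ trace f n ∘ π₁ , π₂ ∘ stepAt f n ⟩

  stepAt-at : ∀ {Γ X Y} {f : StatefulSequence X Y} {n} {x : Γ ⇒ ∏ n X} {y s z} →
              stateAt f n ∘ x ≈ s → U (cells f n) ∘ ⟨ s , y ⟩ ≈ z → stepAt f n ∘ ⟨ x , y ⟩ ≈ z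
  stepAt-at q r = ∘-at (⟨⟩-at (∘-at π₁-at q) π₂-at) r

  run-at : ∀ {Γ X Y} (f : StatefulSequence X Y) n {s} {x : Γ ⇒ ∏ n X} →
           U (run f n) ∘ ⟨ s , x ⟩ ≈ ⟨ stateAt f n ∘ x , trace f n ∘ x ⟩
  -- The empty product is `𝟙`, so the unit `s` fed to the initial cell and the empty input sequence
  -- `x` coincide.
  run-at f zero            = ≈-trans ᵛ-at (⟨⟩-cong (∘-congˡ !-unique₂) !-unique₂)
  run-at f (suc n) {s} {x} = begin
    U (run f n ⨾ cells f n) ∘ ⟨ s , x ⟩                     ≈⟨ ∘-congˡ (⟨⟩-cong ≈-refl (⟨⟩-η x)) ⟨
    U (run f n ⨾ cells f n) ∘ ⟨ s , ⟨ π₁ ∘ x , π₂ ∘ x ⟩ ⟩   ≈⟨ ⨾-at (run-at f n) (≈-sym (⟨⟩-η _)) ⟩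
    ⟨ π₁ ∘ z , ⟨ trace f n ∘ π₁ ∘ x , π₂ ∘ z ⟩ ⟩            ≈⟨ ⟨⟩-cong (∘-at step ≈-refl) (⟨⟩-at (∘-at ≈-refl ≈-refl) (∘-at step ≈-refl)) ⟨
    ⟨ stateAt f (suc n) ∘ x , trace f (suc n) ∘ x ⟩         ∎
    where
    z = U (cells f n) ∘ ⟨ stateAt f n ∘ π₁ ∘ x , π₂ ∘ x ⟩
    step : stepAt f n ∘ x ≈ z
    step = ∘-at (⟨⟩-at (∘-at ≈-refl ≈-refl) ≈-refl) ≈-refl

  -- `! ᵛ` discards the final state of the run and `unpad` removes the unit wires around it, leaving
  -- the output half of `run-at`.
  Tc≈trace : ∀ {X Y} (f : StatefulSequence X Y) n → Tc n f ≈ trace f (suc n)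
  Tc≈trace f n = ext (λ x → ∘-at
    (∘-at (↑-sym-at (unpad-at {s = !} {t = !})) (⨾-at (run-at f (suc n)) ᵛ-at))
    unpad-at)
    where
    unpad-at : ∀ {Γ X} {s t : Γ ⇒ 𝟙} {x : Γ ⇒ X} → ↑ (unpad X) ∘ ⟨ s , ⟨ x , t ⟩ ⟩ ≈ x
    unpad-at = ↑-trans-at ↑-identityˡ-at ↑-identityʳ-at

  ≋-intro : ∀ {X Y} {f g : StatefulSequence X Y} → (∀ n → trace f n ≈ trace g n) → f ≋ g
  truncations (≋-intro {f = f} {g} q) n =
    ≈-trans (Tc≈trace f n) (≈-trans (q (suc n)) (≈-sym (Tc≈trace g n)))

  trace-cong : ∀ {X Y} {f g : StatefulSequence X Y} → f ≋ g → ∀ n → trace f n ≈ trace g n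
  -- Truncations start at one input, so `q` says nothing here; but every trace at zero is the
  -- identity of `𝟙`.
  trace-cong                 q zero    = ≈-refl
  trace-cong {f = f} {g = g} q (suc n) =
    ≈-trans (≈-sym (Tc≈trace f n)) (≈-trans (truncations q n) (Tc≈trace g n))

  ∏-map : ∀ {X Y : ℕ → Obj} → (∀ k → X k ⇒ Y k) → ∀ n → ∏ n X ⇒ ∏ n Y
  ∏-map φ zero    = id
  ∏-map φ (suc n) = ∏-map φ n ⊗ φ n

  trace-stateless : ∀ {X Y : ℕ → Obj} (φ : ∀ k → X k ⇒ Y k) n → trace (stateless φ) n ≈ ∏-map φ n
  trace-stateless φ zero    = ≈-refl
  trace-stateless φ (suc n) = ⟨⟩-cong (∘-congʳ (trace-stateless φ n)) (≈-trans (∘-congˡ ʰ-at) π₂-at)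

  -- The cell of `g` consumes the output just produced by `f`, hence `trace f (suc n)`. The state
  -- equation at `n` is a premise, so that the induction can then run on states alone; `stepAt-pair`
  -- is arranged in the same way.
  stepAt-compose : ∀ {X Y Z} (g : StatefulSequence Y Z) (f : StatefulSequence X Y) n →
                   stateAt (compose g f) n ≈ ⟨ stateAt f n , stateAt g n ∘ trace f n ⟩ →
                   stepAt (compose g f) n ≈ ⟨ ⟨ π₁ ∘ stepAt f n , π₁ ∘ stepAt g n ∘ trace f (suc n) ⟩ , π₂ ∘ stepAt g n ∘ trace f (suc n) ⟩
  stepAt-compose g f n q = ≈-trans
    (∘-congˡ (⟨⟩-cong (≈-trans (∘-congʳ q) (⟨⟩-at ≈-refl (assoc _ _ _))) ≈-refl))
    (✶-at (≈-sym (⟨⟩-η _)) (≈-trans (≈-sym (stepAt-at {f = g} ≈-refl ≈-refl)) (≈-sym (⟨⟩-η _))))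

  stateAt-compose : ∀ {X Y Z} (g : StatefulSequence Y Z) (f : StatefulSequence X Y) n →
                    stateAt (compose g f) n ≈ ⟨ stateAt f n , stateAt g n ∘ trace f n ⟩
  stateAt-compose g f zero    = ⟨⟩-cong ≈-refl (≈-sym (identityʳ _))
  stateAt-compose g f (suc n) = ≈-trans (∘-congˡ (stepAt-compose g f n (stateAt-compose g f n)))
    (≈-trans π₁-at (⟨⟩-cong ≈-refl (≈-sym (assoc _ _ _))))

  trace-∘ : ∀ {X Y Z} (g : StatefulSequence Y Z) (f : StatefulSequence X Y) n →
            trace (compose g f) n ≈ trace g n ∘ trace f n
  trace-∘ g f zero    = ≈-sym (identityˡ _)
  trace-∘ g f (suc n) = begin
    ⟨ trace (compose g f) n ∘ π₁ , π₂ ∘ stepAt (compose g f) n ⟩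
      ≈⟨ ⟨⟩-cong (≈-trans (∘-congʳ (trace-∘ g f n)) (assoc _ _ _))
                 (≈-trans (∘-congˡ (stepAt-compose g f n (stateAt-compose g f n))) π₂-at) ⟩
    ⟨ trace g n ∘ trace f n ∘ π₁ , π₂ ∘ stepAt g n ∘ trace f (suc n) ⟩
      ≈⟨ ⟨⟩-at (∘-at π₁-at ≈-refl) (assoc _ _ _) ⟨
    trace g (suc n) ∘ trace f (suc n) ∎

  stepAt-pair : ∀ {X Y Z : ℕ → Obj} (f : StatefulSequence X Y) (g : StatefulSequence X Z) n →
                stateAt (pair f g) n ≈ ⟨ stateAt f n , stateAt g n ⟩ →
                stepAt (pair f g) n ≈ ⟨ ⟨ π₁ ∘ stepAt f n , π₁ ∘ stepAt g n ⟩ , ⟨ π₂ ∘ stepAt f n , π₂ ∘ stepAt g n ⟩ ⟩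
  stepAt-pair f g n q = ≈-trans
    (∘-congˡ (⟨⟩-cong (≈-trans (∘-congʳ q) (⟨⟩-∘ _ _ _)) ≈-refl))
    (⟨⟩-at (⟨⟩-at (∘-at s′y ≈-refl) (∘-at t′z ≈-refl)) (⟨⟩-at (∘-at s′y ≈-refl) (∘-at t′z ≈-refl)))
    where
    s′y : _ ≈ stepAt f n
    s′y = ∘-at (⟨⟩-at (∘-at π₁-at π₁-at) π₂-at) ≈-refl
    t′z : _ ≈ stepAt g n
    t′z = ∘-at (⟨⟩-at (∘-at π₁-at π₂-at) π₂-at) ≈-refl

  stateAt-pair : ∀ {X Y Z : ℕ → Obj} (f : StatefulSequence X Y) (g : StatefulSequence X Z) n →
                 stateAt (pair f g) n ≈ ⟨ stateAt f n , stateAt g n ⟩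
  stateAt-pair f g zero    = ≈-refl
  stateAt-pair f g (suc n) = ≈-trans (∘-congˡ (stepAt-pair f g n (stateAt-pair f g n))) π₁-at

  trace-pair₁ : ∀ {X Y Z : ℕ → Obj} (f : StatefulSequence X Y) (g : StatefulSequence X Z) n →
                ∏-map (λ k → π₁) n ∘ trace (pair f g) n ≈ trace f n
  trace-pair₁ f g zero    = identityˡ _
  trace-pair₁ f g (suc n) = ⊗-at (≈-trans (≈-sym (assoc _ _ _)) (∘-congʳ (trace-pair₁ f g n)))
    (≈-trans (∘-congˡ (≈-trans (∘-congˡ (stepAt-pair f g n (stateAt-pair f g n))) π₂-at)) π₁-at)

  trace-pair₂ : ∀ {X Y Z : ℕ → Obj} (f : StatefulSequence X Y) (g : StatefulSequence X Z) n →
                ∏-map (λ k → π₂) n ∘ trace (pair f g) n ≈ trace g n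
  trace-pair₂ f g zero    = identityˡ _
  trace-pair₂ f g (suc n) = ⊗-at (≈-trans (≈-sym (assoc _ _ _)) (∘-congʳ (trace-pair₂ f g n)))
    (≈-trans (∘-congˡ (≈-trans (∘-congˡ (stepAt-pair f g n (stateAt-pair f g n))) π₂-at)) π₂-at)

  ∏-map-cong : ∀ {X Y : ℕ → Obj} {φ ψ : ∀ k → X k ⇒ Y k} → (∀ k → φ k ≈ ψ k) → ∀ n → ∏-map φ n ≈ ∏-map ψ n
  ∏-map-cong q zero    = ≈-refl
  ∏-map-cong q (suc n) = ⊗-cong (∏-map-cong q n) (q n)

  ∏-map-id : ∀ {X : ℕ → Obj} n → ∏-map (λ k → id {X k}) n ≈ id
  ∏-map-id zero    = ≈-refl
  ∏-map-id (suc n) = ext₂ (λ x y → ≈-trans (⊗-at (≈-trans (∘-congʳ (∏-map-id n)) id-at) id-at) (≈-sym id-at))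

  ∏-map-∘ : ∀ {X Y Z : ℕ → Obj} (ψ : ∀ k → Y k ⇒ Z k) (φ : ∀ k → X k ⇒ Y k) n →
            ∏-map (λ k → ψ k ∘ φ k) n ≈ ∏-map ψ n ∘ ∏-map φ n
  ∏-map-∘ ψ φ zero    = ≈-sym (identityˡ _)
  ∏-map-∘ ψ φ (suc n) = ext₂ (λ x y →
    ≈-trans (⊗-at (≈-trans (∘-congʳ (∏-map-∘ ψ φ n)) (assoc _ _ _)) (assoc _ _ _))
    (≈-sym (∘-at (⊗-at ≈-refl ≈-refl) (⊗-at ≈-refl ≈-refl))))

  -- The last entry is determined by its two projections and the earlier entries by induction;
  -- `⊗-equal₁` and `⊗-equal₂` separate these two parts of each hypothesis.
  ∏-map-π-jointlyMonic : ∀ {Γ} {X Y : ℕ → Obj} n {f g : Γ ⇒ ∏ n (λ k → X k × Y k)} →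
    ∏-map (λ k → π₁ {X k} {Y k}) n ∘ f ≈ ∏-map (λ k → π₁) n ∘ g →
    ∏-map (λ k → π₂ {X k} {Y k}) n ∘ f ≈ ∏-map (λ k → π₂) n ∘ g → f ≈ g
  ∏-map-π-jointlyMonic zero    q r = !-unique₂
  ∏-map-π-jointlyMonic (suc n) q r = π-jointlyMonic
    (∏-map-π-jointlyMonic n (⊗-equal₁ q) (⊗-equal₁ r))
    (π-jointlyMonic (⊗-equal₂ q) (⊗-equal₂ r))

  ∏-𝟙-unique : ∀ {Γ} n {f g : Γ ⇒ ∏ n (λ k → 𝟙)} → f ≈ g
  ∏-𝟙-unique zero    = !-unique₂
  ∏-𝟙-unique (suc n) = π-jointlyMonic (∏-𝟙-unique n) !-unique₂

  -- Extensional equality and the structural maps of `St`.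

  ≋-refl : ∀ {X Y} {f : StatefulSequence X Y} → f ≋ f
  ≋-refl = ≋-intro (λ n → ≈-refl)

  ≋-sym : ∀ {X Y} {f g : StatefulSequence X Y} → f ≋ g → g ≋ f
  ≋-sym q = ≋-intro (λ n → ≈-sym (trace-cong q n))

  ≋-trans : ∀ {X Y} {f g h : StatefulSequence X Y} → f ≋ g → g ≋ h → f ≋ h
  ≋-trans q r = ≋-intro (λ n → ≈-trans (trace-cong q n) (trace-cong r n))

  compose-cong : ∀ {X Y Z} {g g′ : StatefulSequence Y Z} {f f′ : StatefulSequence X Y} →
                 g ≋ g′ → f ≋ f′ → compose g f ≋ compose g′ f′
  compose-cong {g = g} {g′} {f} {f′} q r = ≋-intro (λ n →
    ≈-trans (trace-∘ g f n) (≈-trans (∘-cong (trace-cong q n) (trace-cong r n)) (≈-sym (trace-∘ g′ f′ n))))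

  trace-stateless-∘ : ∀ {X Y Z : ℕ → Obj} (φ : ∀ k → Y k ⇒ Z k) (f : StatefulSequence X Y) n →
                      trace (compose (stateless φ) f) n ≈ ∏-map φ n ∘ trace f n
  trace-stateless-∘ φ f n = ≈-trans (trace-∘ _ f n) (∘-congʳ (trace-stateless φ n))

  private
    module St = RawLeftAdditiveCategory St

  project₁-St : ∀ {X Y Z : ℕ → Obj} (f : StatefulSequence X Y) (g : StatefulSequence X Z) → compose St.π₁ (pair f g) ≋ f
  project₁-St f g = ≋-intro (λ n → ≈-trans (trace-stateless-∘ _ _ n) (trace-pair₁ f g n))

  project₂-St : ∀ {X Y Z : ℕ → Obj} (f : StatefulSequence X Y) (g : StatefulSequence X Z) → compose St.π₂ (pair f g) ≋ g
  project₂-St f g = ≋-intro (λ n → ≈-trans (trace-stateless-∘ _ _ n) (trace-pair₂ f g n))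

  ⟨⟩-unique-St : ∀ {X Y Z : ℕ → Obj} {f : StatefulSequence X Y} {g : StatefulSequence X Z} {h} →
                 compose St.π₁ h ≋ f → compose St.π₂ h ≋ g → pair f g ≋ h
  ⟨⟩-unique-St {f = f} {g} {h} q r = ≋-intro (λ n → ∏-map-π-jointlyMonic n
    (≈-trans (trace-pair₁ f g n) (≈-trans (≈-sym (trace-cong q n)) (trace-stateless-∘ _ h n)))
    (≈-trans (trace-pair₂ f g n) (≈-trans (≈-sym (trace-cong r n)) (trace-stateless-∘ _ h n))))

  stateless-cong : ∀ {X Y : ℕ → Obj} {φ ψ : ∀ k → X k ⇒ Y k} → (∀ k → φ k ≈ ψ k) → stateless φ ≋ stateless ψ
  stateless-cong q = ≋-intro (λ n →
    ≈-trans (trace-stateless _ n) (≈-trans (∏-map-cong q n) (≈-sym (trace-stateless _ n))))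

  -- A composite of stateless sequences has state `𝟙 × 𝟙`, so it is stateless only extensionally.
  -- Premises up to `≋` make this rule and its companions for pairing and `⊗` nest along the shape
  -- of a structural map.
  stateless-∘ : ∀ {X Y Z : ℕ → Obj} {g : StatefulSequence Y Z} {f : StatefulSequence X Y} {ψ φ} →
                g ≋ stateless ψ → f ≋ stateless φ → compose g f ≋ stateless (λ k → ψ k ∘ φ k)
  stateless-∘ {g = g} {f} {ψ} {φ} q r = ≋-intro (λ n → begin
    trace (compose g f) n                   ≈⟨ trace-∘ g f n ⟩
    trace g n ∘ trace f n                   ≈⟨ ∘-cong (≈-trans (trace-cong q n) (trace-stateless ψ n))
                                                      (≈-trans (trace-cong r n) (trace-stateless φ n)) ⟩
    ∏-map ψ n ∘ ∏-map φ n                   ≈⟨ ∏-map-∘ ψ φ n ⟨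
    ∏-map (λ k → ψ k ∘ φ k) n               ≈⟨ trace-stateless _ n ⟨
    trace (stateless (λ k → ψ k ∘ φ k)) n   ∎)

  stateless-⟨⟩ : ∀ {X Y Z : ℕ → Obj} {f : StatefulSequence X Y} {g : StatefulSequence X Z} {φ ψ} →
                 f ≋ stateless φ → g ≋ stateless ψ → pair f g ≋ stateless (λ k → ⟨ φ k , ψ k ⟩)
  stateless-⟨⟩ q r = ⟨⟩-unique-St
    (≋-trans (stateless-∘ ≋-refl ≋-refl) (≋-trans (stateless-cong (λ k → π₁-at)) (≋-sym q)))
    (≋-trans (stateless-∘ ≋-refl ≋-refl) (≋-trans (stateless-cong (λ k → π₂-at)) (≋-sym r)))

  stateless-⊗ : ∀ {X X′ Y Y′ : ℕ → Obj} {f : StatefulSequence X X′} {g : StatefulSequence Y Y′} {φ ψ} →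
                f ≋ stateless φ → g ≋ stateless ψ → f St.⊗ g ≋ stateless (λ k → φ k ⊗ ψ k)
  stateless-⊗ q r = stateless-⟨⟩ (stateless-∘ q ≋-refl) (stateless-∘ r ≋-refl)

  stateless-δ : ∀ X Y → St.δ X Y ≋ stateless (λ k → δ (X k) (Y k))
  stateless-δ X Y = stateless-∘ ≋-refl
    (stateless-∘ (stateless-⊗ ≋-refl (stateless-⊗ (stateless-⟨⟩ ≋-refl ≋-refl) ≋-refl)) ≋-refl)

  -- Reduces a law between structural maps of `St` to the same law of `C` at each entry.
  pointwise : ∀ {X Y : ℕ → Obj} {f g : StatefulSequence X Y} {φ ψ} →
              f ≋ stateless φ → g ≋ stateless ψ → (∀ k → φ k ≈ ψ k) → f ≋ g
  pointwise q r s = ≋-trans q (≋-trans (stateless-cong s) (≋-sym r))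

  St-isCategory : IsCategory St
  St-isCategory = record
    { ≈-isEquivalence = record { refl = ≋-refl ; sym = ≋-sym ; trans = ≋-trans }
    ; ∘-cong    = compose-cong
    ; assoc     = λ h g f → ≋-intro (λ n → begin
        trace (compose (compose h g) f) n      ≈⟨ trace-∘ (compose h g) f n ⟩
        trace (compose h g) n ∘ trace f n      ≈⟨ ∘-congʳ (trace-∘ h g n) ⟩
        (trace h n ∘ trace g n) ∘ trace f n    ≈⟨ ∘-at (≈-sym (trace-∘ g f n)) (≈-sym (trace-∘ h (compose g f) n)) ⟩
        trace (compose h (compose g f)) n      ∎)
    ; identityˡ = λ f → ≋-intro (λ n →
        ≈-trans (trace-stateless-∘ _ f n) (≈-trans (∘-congʳ (∏-map-id n)) (identityˡ _)))
    ; identityʳ = λ f → ≋-intro (λ n →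
        ≈-trans (trace-∘ f _ n) (≈-trans (∘-congˡ (≈-trans (trace-stateless _ n) (∏-map-id n))) (identityʳ _)))
    ; ↑-id      = λ q → stateless-cong (λ k → ↑-id (q k))
    ; ↑-trans   = λ q r → pointwise ≋-refl (stateless-∘ ≋-refl ≋-refl) (λ k → ↑-trans (q k) (r k))
    }

  St-isStrictCartesian : IsStrictCartesian St
  St-isStrictCartesian = record
    { isCategory  = St-isCategory
    ; !-unique    = λ f → ≋-intro (λ n → ∏-𝟙-unique n)
    ; project₁    = project₁-St
    ; project₂    = project₂-St
    ; ⟨⟩-unique   = ⟨⟩-unique-St
    ; ↑-×         = λ q r → pointwise ≋-refl (stateless-⊗ ≋-refl ≋-refl) (λ k → ↑-× (q k) (r k))
    ; ↑-assoc     = λ X Y Z → pointwise ≋-refl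
        (stateless-⟨⟩ (stateless-∘ ≋-refl ≋-refl) (stateless-⟨⟩ (stateless-∘ ≋-refl ≋-refl) ≋-refl))
        (λ k → ↑-assoc (X k) (Y k) (Z k))
    ; ↑-identityˡ = λ X → stateless-cong (λ k → ↑-identityˡ (X k))
    ; ↑-identityʳ = λ X → stateless-cong (λ k → ↑-identityʳ (X k))
    }

-- Left additive structure of `St`, and unzipping.

module StatefulAdditiveProperties {o p ℓ e} {C : RawLeftAdditiveCategory o p ℓ e} (C-isLeftAdditive : IsLeftAdditiveCategory C) where
  open RawLeftAdditiveCategory C
  open IsLeftAdditiveCategory C-isLeftAdditive
  open LeftAdditiveProperties C-isLeftAdditive
  open HomReasoning
  open Stateful C
  open StatefulProperties isStrictCartesian public

  St-isLeftAdditiveCategory : IsLeftAdditiveCategory St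
  St-isLeftAdditiveCategory = record
    { isStrictCartesian = St-isStrictCartesian
    ; +-≐         = λ q → pointwise (stateless-∘ ≋-refl (stateless-∘ ≋-refl ≋-refl)) ≋-refl (λ k → +-≐ (q k))
    ; 0-≐         = λ q → pointwise (stateless-∘ ≋-refl (stateless-∘ ≋-refl ≋-refl)) ≋-refl (λ k → 0-≐ (q k))
    ; +-assoc     = λ X → pointwise (stateless-∘ ≋-refl (stateless-⊗ ≋-refl ≋-refl))
        (stateless-∘ ≋-refl (stateless-∘ (stateless-⊗ ≋-refl ≋-refl) ≋-refl)) (λ k → +-assoc (X k))
    ; +-comm      = λ X → pointwise (stateless-∘ ≋-refl (stateless-⟨⟩ ≋-refl ≋-refl)) ≋-refl (λ k → +-comm (X k))
    ; +-identityˡ = λ X → pointwise (stateless-∘ ≋-refl (stateless-⊗ ≋-refl ≋-refl)) ≋-refl (λ k → +-identityˡ (X k))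
    ; +-identityʳ = λ X → pointwise (stateless-∘ ≋-refl (stateless-⊗ ≋-refl ≋-refl)) ≋-refl (λ k → +-identityʳ (X k))
    ; 0-×         = λ X Y → pointwise ≋-refl (stateless-∘ (stateless-⊗ ≋-refl ≋-refl) ≋-refl) (λ k → 0-× (X k) (Y k))
    ; +-×         = λ X Y → pointwise ≋-refl (stateless-∘ (stateless-⊗ ≋-refl ≋-refl) (stateless-δ X Y)) (λ k → +-× (X k) (Y k))
    }

  ∏-π₁ : ∀ (X Y : ℕ → Obj) n → ∏ n (λ k → X k × Y k) ⇒ ∏ n X
  ∏-π₁ X Y = ∏-map (λ k → π₁)

  ∏-π₂ : ∀ (X Y : ℕ → Obj) n → ∏ n (λ k → X k × Y k) ⇒ ∏ n Y
  ∏-π₂ X Y = ∏-map (λ k → π₂)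

  unzip : ∀ (X Y : ℕ → Obj) n → ∏ n (λ k → X k × Y k) ⇒ ∏ n X × ∏ n Y
  unzip X Y n = ⟨ ∏-π₁ X Y n , ∏-π₂ X Y n ⟩

  unzip-at : ∀ {Γ} {X Y : ℕ → Obj} n {x : Γ ⇒ ∏ n (λ k → X k × Y k)} {y} →
             unzip X Y (suc n) ∘ ⟨ x , y ⟩ ≈
             ⟨ ⟨ ∏-π₁ X Y n ∘ x , π₁ ∘ y ⟩ , ⟨ ∏-π₂ X Y n ∘ x , π₂ ∘ y ⟩ ⟩
  unzip-at {X = X} {Y} n = ⟨⟩-at (⊗-at {f = ∏-π₁ X Y n} ≈-refl ≈-refl) (⊗-at {f = ∏-π₂ X Y n} ≈-refl ≈-refl)

  -- Entrywise addition receives interleaved summands, while `+[ ∏ n X ]` adds two whole sequences;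
  -- `unzip` mediates, and `+-×` gives the induction step.
  ∏-map-+ : ∀ (X : ℕ → Obj) n → ∏-map (λ k → +[ X k ]) n ≈ +[ ∏ n X ] ∘ unzip X X n
  ∏-map-+ X zero    = !-unique₂
  ∏-map-+ X (suc n) = ext₂ (λ x y → begin
    (∏-map (λ k → +[ X k ]) n ⊗ +[ X n ]) ∘ ⟨ x , y ⟩
      ≈⟨ ⊗-at (≈-trans (∘-congʳ (∏-map-+ X n)) (∘-at (⟨⟩-∘ _ _ _) ≈-refl)) (∘-congˡ (≈-sym (⟨⟩-η y))) ⟩
    ⟨ ∏-π₁ X X n ∘ x ⊹ ∏-π₂ X X n ∘ x , π₁ ∘ y ⊹ π₂ ∘ y ⟩
      ≈⟨ ∘-at (unzip-at {X = X} {X} n) +-×-at ⟨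
    (+[ ∏ (suc n) X ] ∘ unzip X X (suc n)) ∘ ⟨ x , y ⟩ ∎)

  -- The source is a power of `𝟙` rather than `𝟙` itself. Stating this at an arbitrary `x` lets the
  -- induction hypothesis be used at `π₁ ∘ x`.
  ∏-map-0 : ∀ {Γ} (X : ℕ → Obj) n {x : Γ ⇒ ∏ n (λ k → 𝟙)} → ∏-map (λ k → 0[ X k ]) n ∘ x ≈ 𝟎
  ∏-map-0 X zero        = !-unique₂
  ∏-map-0 X (suc n) {x} = begin
    (∏-map (λ k → 0[ X k ]) n ⊗ 0[ X n ]) ∘ x   ≈⟨ ⟨⟩-at (∘-at ≈-refl (∏-map-0 X n)) (∘-at ≈-refl 0-at) ⟩
    ⟨ 𝟎 , 𝟎 ⟩                                   ≈⟨ 0-×-at ⟨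
    𝟎                                           ∎

-- Derivatives of states and truncations.

module StatefulDifferentialProperties {o p ℓ e} (C : CartesianDifferentialCategory o p ℓ e) where
  open CartesianDifferentialCategory C
  open DifferentialProperties C
  open HomReasoning
  open Stateful rawLeftAdditiveCategory
  open Derivative D
  open StatefulAdditiveProperties isLeftAdditiveCategory

  ∏-map-linear : ∀ {X Y : ℕ → Obj} {φ : ∀ k → X k ⇒ Y k} → (∀ k → IsLinear (φ k)) → ∀ n → IsLinear (∏-map φ n)
  ∏-map-linear q zero    = id-linear
  ∏-map-linear q (suc n) = ⊗-linear (∏-map-linear q n) (q n)

  trace-linear : ∀ {X Y : ℕ → Obj} {φ : ∀ k → X k ⇒ Y k} → (∀ k → IsLinear (φ k)) → ∀ n → IsLinear (trace (stateless φ) n)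
  trace-linear q n = IsLinear-resp (trace-stateless _ n) (∏-map-linear q n)

  -- `𝒟` groups the two states and the two inputs, whereas `D` wants the tangents before the base
  -- points; the regrouping is done here once.
  𝒟-at : ∀ {Γ S S′ X Y} {f : TwoCell S X S′ Y} {ṡ s : Γ ⇒ S} {ẋ x : Γ ⇒ X} {z w} →
         D (U f) ∘ ⟨ ⟨ ṡ , ẋ ⟩ , ⟨ s , x ⟩ ⟩ ≈ z → U f ∘ ⟨ s , x ⟩ ≈ w →
         U (𝒟 f) ∘ ⟨ ⟨ ṡ , s ⟩ , ⟨ ẋ , x ⟩ ⟩ ≈ ⟨ ⟨ π₁ ∘ z , π₁ ∘ w ⟩ , π₂ ∘ z ⟩
  𝒟-at {f = f} {ṡ} {s} {ẋ} {x} {z} q r = ⟨⟩-at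
    (⟨⟩-at (∘-at ṡ′ẏ ≈-refl) (∘-at (∘-at (⟨⟩-at (∘-at π₁-at π₂-at) (∘-at π₂-at π₂-at)) r) ≈-refl))
    (∘-at ṡ′ẏ ≈-refl)
    where
    ṡ′ẏ : _ ∘ ⟨ ⟨ ṡ , s ⟩ , ⟨ ẋ , x ⟩ ⟩ ≈ z
    ṡ′ẏ = ∘-at (⟨⟩-at (⟨⟩-at (∘-at π₁-at π₁-at) (∘-at π₂-at π₁-at)) (⟨⟩-at (∘-at π₁-at π₂-at) (∘-at π₂-at π₂-at))) q

  -- Since maps into `𝟙` are unique, `x` and `y` can be chosen freely when `𝟙⁴≐𝟙` is inverted. The
  -- freedom lets the base case below take them to be the two halves of the unzipped empty sequence.
  init-𝒟⋆ : ∀ {X Y : ℕ → Obj} (f : StatefulSequence X Y) {x y : 𝟙 ⇒ 𝟙} →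
            init (𝒟⋆ f) ≈ ⟨ D (init f) ∘ ⟨ x , y ⟩ , init f ∘ y ⟩
  init-𝒟⋆ f = ≈-trans (≈-sym (identityʳ _)) (∘-at
    (∘-at (↑-sym-at (↑-trans-at (↑-×-at ↑-identityˡ-at (↑-identityˡ-at {y = !})) ↑-identityˡ-at))
          (𝒟-at {f = init f ᵛ} D-ᵛ-at ᵛ-at))
    (≈-trans ↑-identityʳ-at (⟨⟩-cong π₁-at π₁-at)))
    where
    D-ᵛ-at : ∀ {Γ X Y} {φ : X ⇒ Y} {ẋ x : Γ ⇒ X} {ṡ s : Γ ⇒ 𝟙} →
             D (U (φ ᵛ)) ∘ ⟨ ⟨ ẋ , ṡ ⟩ , ⟨ x , s ⟩ ⟩ ≈ ⟨ D φ ∘ ⟨ ẋ , x ⟩ , ! ⟩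
    -- The casts hidden in `φ ᵛ` are removed under `D` by rewriting it as a plain pairing.
    D-ᵛ-at {φ = φ} = ≈-trans
      (∘-congʳ (D-cong (ext₂ {g = ⟨ φ ∘ π₁ , ! ⟩} (λ _ _ → ≈-trans ᵛ-at (≈-sym (⟨⟩-at (∘-at π₁-at ≈-refl) !-unique₂))))))
      (D-⟨⟩-at (D-∘-at D-π₁-at π₁-at ≈-refl) !-unique₂)

  -- The chain rule for one step: the derivative of the state is the tangent state at which the cell
  -- is differentiated, in the grouping that `𝒟-at` expects.
  D-stepAt-at : ∀ {Γ} {X Y : ℕ → Obj} (f : StatefulSequence X Y) n {ẋ x : Γ ⇒ ∏ n X} {ẏ y} →
                D (stepAt f n) ∘ ⟨ ⟨ ẋ , ẏ ⟩ , ⟨ x , y ⟩ ⟩ ≈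
                D (U (cells f n)) ∘ ⟨ ⟨ D (stateAt f n) ∘ ⟨ ẋ , x ⟩ , ẏ ⟩ , ⟨ stateAt f n ∘ x , y ⟩ ⟩
  D-stepAt-at f n = D-∘-at (D-⟨⟩-at (D-∘-at D-π₁-at π₁-at ≈-refl) D-π₂-at) (⟨⟩-at (∘-at π₁-at ≈-refl) π₂-at) ≈-refl

  mutual
    -- The invariant behind the whole comparison. Differentiating the next cell requires both the
    -- tangent of the current state and its base value, and these are the two components that `𝒟`
    -- passes on.
    stateAt-𝒟⋆ : ∀ {X Y : ℕ → Obj} (f : StatefulSequence X Y) n →
                 stateAt (𝒟⋆ f) n ≈ ⟨ D (stateAt f n) , stateAt f n ∘ π₂ ⟩ ∘ unzip X X n
    stateAt-𝒟⋆     f zero    = ≈-trans (init-𝒟⋆ f) (≈-sym (⟨⟩-at ≈-refl (∘-at π₂-at ≈-refl)))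
    stateAt-𝒟⋆ {X} f (suc n) = begin
      π₁ ∘ stepAt (𝒟⋆ f) n
        ≈⟨ ∘-congˡ (stepAt-𝒟⋆ f n) ⟩
      π₁ ∘ ⟨ ⟨ π₁ ∘ D (stepAt f n) , π₁ ∘ stepAt f n ∘ π₂ ⟩ , π₂ ∘ D (stepAt f n) ⟩ ∘ unzip X X (suc n)
        ≈⟨ ≈-trans (≈-sym (assoc _ _ _)) (∘-congʳ π₁-at) ⟩
      ⟨ π₁ ∘ D (stepAt f n) , π₁ ∘ stepAt f n ∘ π₂ ⟩ ∘ unzip X X (suc n)
        -- Selecting the next state commutes with `D` because `π₁` is linear.
        ≈⟨ ∘-congʳ (⟨⟩-cong (≈-sym (D-linear-∘ π₁-linear)) (≈-sym (assoc _ _ _))) ⟩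
      ⟨ D (π₁ ∘ stepAt f n) , (π₁ ∘ stepAt f n) ∘ π₂ ⟩ ∘ unzip X X (suc n) ∎

    stepAt-𝒟⋆ : ∀ {X Y : ℕ → Obj} (f : StatefulSequence X Y) n →
                stepAt (𝒟⋆ f) n ≈ ⟨ ⟨ π₁ ∘ D (stepAt f n) , π₁ ∘ stepAt f n ∘ π₂ ⟩ , π₂ ∘ D (stepAt f n) ⟩ ∘ unzip X X (suc n)
    stepAt-𝒟⋆ {X} f n = ext₂ (λ x y → ≈-trans
      (stepAt-at {f = 𝒟⋆ f}
        (≈-trans (∘-congʳ (stateAt-𝒟⋆ f n)) (∘-at (⟨⟩-∘ _ _ _) (⟨⟩-at ≈-refl (∘-at π₂-at ≈-refl))))
        (≈-trans (∘-congˡ (⟨⟩-cong ≈-refl (≈-sym (⟨⟩-η y))))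
                 (𝒟-at (≈-sym (D-stepAt-at f n)) (≈-sym (stepAt-at {f = f} ≈-refl ≈-refl)))))
      (≈-sym (∘-at (unzip-at {X = X} {X} n)
        (⟨⟩-at (⟨⟩-at (∘-at ≈-refl ≈-refl) (∘-at (∘-at π₂-at ≈-refl) ≈-refl)) (∘-at ≈-refl ≈-refl)))))

  -- The earlier outputs factor through `π₁`, whose derivative drops the last input, so the
  -- induction hypothesis covers them. The new output is the output half of `stepAt-𝒟⋆`.
  trace-𝒟⋆ : ∀ {X Y : ℕ → Obj} (f : StatefulSequence X Y) n → trace (𝒟⋆ f) n ≈ D (trace f n) ∘ unzip X X n
  trace-𝒟⋆     f zero    = !-unique₂
  trace-𝒟⋆ {X} f (suc n) = ext₂ (λ x y → begin
    ⟨ trace (𝒟⋆ f) n ∘ π₁ , π₂ ∘ stepAt (𝒟⋆ f) n ⟩ ∘ ⟨ x , y ⟩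
      ≈⟨ ⟨⟩-at (∘-at π₁-at (≈-trans (∘-congʳ (trace-𝒟⋆ f n)) (∘-at (⟨⟩-∘ _ _ _) ≈-refl)))
               (∘-at (≈-trans (∘-congʳ (stepAt-𝒟⋆ f n)) (∘-at (unzip-at {X = X} {X} n) (⟨⟩-∘ _ _ _)))
                     (≈-trans π₂-at (assoc _ _ _))) ⟩
    ⟨ D (trace f n) ∘ ⟨ ∏-π₁ X X n ∘ x , ∏-π₂ X X n ∘ x ⟩ ,
      π₂ ∘ D (stepAt f n) ∘ ⟨ ⟨ ∏-π₁ X X n ∘ x , π₁ ∘ y ⟩ , ⟨ ∏-π₂ X X n ∘ x , π₂ ∘ y ⟩ ⟩ ⟩
      ≈⟨ ∘-at (unzip-at {X = X} {X} n)
              (D-⟨⟩-at (D-∘-at D-π₁-at π₁-at ≈-refl) (D-∘-at ≈-refl ≈-refl (IsLinear-at π₂-linear))) ⟨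
    (D (trace f (suc n)) ∘ unzip X X (suc n)) ∘ ⟨ x , y ⟩ ∎)

  trace-π : ∀ {X Y : ℕ → Obj} n →
            ⟨ trace (stateless (λ k → π₁ {X k} {Y k})) n , trace (stateless (λ k → π₂ {X k} {Y k})) n ⟩ ≈ unzip X Y n
  trace-π n = ⟨⟩-cong (trace-stateless _ n) (trace-stateless _ n)

  truncationFunctors : JointlyFaithfulDifferentialFunctors St C ℕ 𝒟⋆
  truncationFunctors = record
    { F₀       = ∏
    ; F        = λ n f → trace f n
    ; F-cong   = λ n q → trace-cong q n
    ; faithful = ≋-intro
    ; F-id     = λ n → ≈-trans (trace-stateless _ n) (∏-map-id n)
    ; F-∘      = λ n g f → trace-∘ g f n
    ; F-𝟙      = λ n → ∏-𝟙-unique n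
    ; F-×      = λ n q r → ∏-map-π-jointlyMonic n
        (≈-trans (∘-congʳ (≈-sym (trace-stateless _ n))) (≈-trans q (∘-congʳ (trace-stateless _ n))))
        (≈-trans (∘-congʳ (≈-sym (trace-stateless _ n))) (≈-trans r (∘-congʳ (trace-stateless _ n))))
    ; F-+      = λ n X → ≈-trans (trace-stateless _ n) (≈-trans (∏-map-+ X n) (∘-congˡ (≈-sym (trace-π n))))
    ; F-0      = λ n X → ≈-trans (trace-stateless _ n) (≈-trans (≈-sym (identityʳ _)) (∏-map-0 X n))
    ; F-↑      = λ n q → trace-linear (λ k → ↑-linear) n
    ; F-π₁     = λ n → trace-linear (λ k → π₁-linear) n
    ; F-π₂     = λ n → trace-linear (λ k → π₂-linear) n
    ; F-𝒟      = λ n f → ≈-trans (trace-𝒟⋆ f n) (∘-congˡ (≈-sym (trace-π n)))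
    }

theorem38 : ∀ {o p ℓ e} (C : CartesianDifferentialCategory o p ℓ e) →
    let open CartesianDifferentialCategory C
        open Stateful rawLeftAdditiveCategory
        open Derivative D
    in IsCartesianDifferentialCategory St 𝒟⋆
theorem38 C = DifferentialReflection.reflects St-isLeftAdditiveCategory truncationFunctors
  where
  open CartesianDifferentialCategory C using (isLeftAdditiveCategory)
  open StatefulAdditiveProperties isLeftAdditiveCategory using (St-isLeftAdditiveCategory)
  open StatefulDifferentialProperties C using (truncationFunctors)
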